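{- For $n\ge 0$ let $p_n:=\prod_{m=0}^{n-1}\big(y-c+\tfrac{m(m+1)}{2}\big)\in\mathcal S=\mathbb C[c][y]$ (so $p_0=1$). Then $\{p_n\}_{n\ge0}$ is a basis of the free $\mathbb C[c]$-module $\mathcal S$ which is orthogonal with respect to $\langle\cdot,\cdot\rangle$: $\langle p_n,p_k\rangle=0$ for $n\neq k$.
   Context: Shares: two ordered oriented lines (strands 1, 2) with $2n$ distinct marked points partitioned into $n$ pairs (chords), up to orientation-preserving diffeomorphisms of each strand; a chord is an arch if its endpoints are on one strand, a bridge otherwise. $A_2$: complex vector space with basis the shares. Closure of a share: glue end of strand 1 to beginning of strand 2 and end of strand 2 to beginning of strand 1 into an oriented circle; two chords intersect if their endpoints alternate in the closure. Dot product $I\cdot H$: strand $i$ of $I$ followed by strand $i$ of $H$; $(I,H)$ = closure of $I\cdot H$, extended bilinearly. $w_{\mathfrak{sl}_2}$ of a chord diagram: with $x_1=\tfrac12\begin{pmatrix}0&1\\1&0\end{pmatrix}$, $x_2=\tfrac12\begin{pmatrix}0&-i\\ i&0\end{pmatrix}$, $x_3=\tfrac12\begin{pmatrix}1&0\\0&-1\end{pmatrix}$ and endpoints $p_1,\dots,p_{2n}$ read from a cut point, $w_{\mathfrak{sl}_2}(D)=\sum_\varphi x_{\varphi(p_1)}\cdots x_{\varphi(p_{2n})}$ over maps $\varphi$ from chords to $\{1,2,3\}$; it lies in $\mathbb C[c]$, $c=x_1^2+x_2^2+x_3^2$. Elements $I_1,I_2\in A_2$ are equivalent if $w_{\mathfrak{sl}_2}((I_1,H))=w_{\mathfrak{sl}_2}((I_2,H))$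 for all shares $H$; $\mathcal S$ is the quotient. Multiplication by $c$ on $\mathcal S$ corresponds to adding an arch intersecting no chord. The cross product $I\times H$ has strand 1 = strand 1 of $I$ followed by strand 1 of $H$, and strand 2 = strand 2 of $H$ followed by strand 2 of $I$. It is known that $\times$ makes $\mathcal S$ the polynomial algebra $\mathbb C[c][y]$, where $y$ is the class of the one-bridge share; $y^k$ is the class of a share of $k$ pairwise non-intersecting bridges and no arches. The bilinear form $\langle I,H\rangle:=w_{\mathfrak{sl}_2}((I,H))\in\mathbb C[c]$ descends to a $\mathbb C[c]$-bilinear form on $\mathcal S$. -}

module Defs where

open import Level using (Level; _⊔_; 0ℓ)
open import Data.Nat as ℕ using (ℕ; zero; suc)
open import Data.Integer as ℤ using (ℤ; +_; -[1+_])
open import Data.Fin using (Fin; zero; suc)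
open import Data.List using (List; []; _∷_; _++_; map; foldr; reverse; upTo; concatMap; deduplicate; length)
open import Data.Product using (Σ; _×_; _,_; ∃)
open import Relation.Binary.PropositionalEquality using (_≡_)
open import Algebra.Bundles using (Ring; CommutativeRing)
open import Relation.Nullary using (yes; no)

-- Chord diagrams and shares (combinatorial encoding)
--
-- A chord diagram / strand is encoded as a word of chord labels: the
-- endpoints read in order, each endpoint carrying the label (a natural
-- number) of its chord; each label occurs exactly twice in a diagram.

Word : Set
Word = List ℕ

record Share : Set where
  constructor share
  field
    strand₁ : Word
    strand₂ : Word
open Share public

-- Dot product I · H : strand i of I followed by strand i of H.
-- Labels of I are sent to even numbers and labels of H to odd numbers,
-- so that the chords of I and H stay distinct.
evenL oddL : ℕ → ℕ
evenL l = 2 ℕ.* l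
oddL  l = suc (2 ℕ.* l)

_·_ : Share → Share → Share
I · H = share (map evenL (strand₁ I) ++ map oddL (strand₁ H))
              (map evenL (strand₂ I) ++ map oddL (strand₂ H))

-- Closure: end of strand 1 glued to start of strand 2, end of strand 2 to
-- start of strand 1.  The resulting circular chord diagram is recorded as
-- the word read from the cut point at the beginning of strand 1.
closure : Share → Word
closure S = strand₁ S ++ strand₂ S

-- The share representing the monomial c^j y^k of S = C[c][y]:
-- k pairwise non-intersecting bridges (labels 0..k-1, strand 1 reads
-- 0,1,..,k-1 and strand 2 reads k-1,..,0) and j arches intersecting no
-- chord (each one adjacent pair  l l  on strand 1).
monoShare : ℕ → ℕ → Share
monoShare j k =
  share (upTo k ++ concatMap (λ t → (k ℕ.+ t) ∷ (k ℕ.+ t) ∷ []) (upTo j))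
        (reverse (upTo k))

-- The sl₂ weight system, valued in the universal enveloping algebra.
--
-- U(sl₂) (over ℂ) is described by its universal property: an
-- "sl₂-datum" in a ring A is a central square root ι of -1 together with
-- x₁ x₂ x₃ satisfying the commutation relations of the matrices
-- x_a = σ_a / 2 of the paper: [x₁,x₂] = ι x₃, [x₂,x₃] = ι x₁, [x₃,x₁] = ι x₂.
-- (Fin 3 index 0,1,2 stands for x₁,x₂,x₃.)

next : Fin 3 → Fin 3
next zero = suc zero
next (suc zero) = suc (suc zero)
next (suc (suc zero)) = zero

record Sl2Datum {a ℓ : Level} (A : Ring a ℓ) : Set (a ⊔ ℓ) where
  open Ring A using (Carrier; _≈_; _*_; _-_; -_; 1#)
  field
    ι         : Carrier
    x         : Fin 3 → Carrier
    ι-central : ∀ u → ι * u ≈ u * ι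
    ι²        : ι * ι ≈ - 1#
    bracket   : ∀ i → x i * x (next i) - x (next i) * x i ≈ ι * x (next (next i))

module WeightSystem {a ℓ : Level} {A : Ring a ℓ} (D : Sl2Datum A) where
  open Ring A using (Carrier; _+_; _*_; -_; 0#; 1#)
  open Sl2Datum D

  fromℕ : ℕ → Carrier
  fromℕ zero = 0#
  fromℕ (suc n) = 1# + fromℕ n

  fromℤ : ℤ → Carrier
  fromℤ (+ n) = fromℕ n
  fromℤ -[1+ n ] = - fromℕ (suc n)

  prodW : (ℕ → Fin 3) → Word → Carrier
  prodW φ w = foldr (λ l r → x (φ l) * r) 1# w

  update : (ℕ → Fin 3) → ℕ → Fin 3 → (ℕ → Fin 3)
  update φ l i m with l ℕ.≟ m
  ... | yes _ = i
  ... | no  _ = φ m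

  sumAssign : List ℕ → (ℕ → Fin 3) → Word → Carrier
  sumAssign []       φ w = prodW φ w
  sumAssign (l ∷ ls) φ w =
    sumAssign ls (update φ l zero) w
      + (sumAssign ls (update φ l (suc zero)) w
      +  sumAssign ls (update φ l (suc (suc zero))) w)

  wsl2 : Word → Carrier
  wsl2 w = sumAssign (deduplicate ℕ._≟_ w) (λ _ → zero) w

  pairShare : Share → Share → Carrier
  pairShare I H = wsl2 (closure (I · H))

-- Polynomials as coefficient lists (index i = coefficient of t^i)

module PolyOps {t : Level} {T : Set t} (0# : T) (_+_ _*_ : T → T → T) where
  addP : List T → List T → List T
  addP []      q       = q
  addP (u ∷ p) []      = u ∷ p
  addP (u ∷ p) (v ∷ q) = (u + v) ∷ addP p q

  mulP : List T → List T → List T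
  mulP []      q = []
  mulP (u ∷ p) q = addP (map (u *_) q) (0# ∷ mulP p q)

  coeff : List T → ℕ → T
  coeff []      _       = 0#
  coeff (u ∷ p) zero    = u
  coeff (u ∷ p) (suc i) = coeff p i

PolyCℤ PolyCYℤ : Set
PolyCℤ  = List ℤ
PolyCYℤ = List PolyCℤ

module ZC = PolyOps (+ 0) ℤ._+_ ℤ._*_
module ZCY = PolyOps [] ZC.addP ZC.mulP

tri : ℕ → ℕ
tri zero = zero
tri (suc m) = suc m ℕ.+ tri m

factor : ℕ → PolyCYℤ
factor m = ((+ tri m) ∷ ℤ.- (+ 1) ∷ []) ∷ ((+ 1) ∷ []) ∷ []

pPoly : ℕ → PolyCYℤ
pPoly zero    = ((+ 1) ∷ []) ∷ []
pPoly (suc n) = ZCY.mulP (pPoly n) (factor n)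

terms : PolyCYℤ → List (ℤ × ℕ × ℕ)
terms P = concatMap (λ k → map (λ j → (ZC.coeff (ZCY.coeff P k) j , j , k))
                                (upTo (length (ZCY.coeff P k))))
                    (upTo (length P))

-- The bilinear form ⟨P,Q⟩ on S, computed on the representatives in A₂
-- of elements of S given as polynomials P,Q ∈ ℤ[c][y]
-- (c^j y^k represented by monoShare j k), extended bilinearly.
module Pairing {a ℓ : Level} {A : Ring a ℓ} (D : Sl2Datum A) where
  open Ring A using (Carrier; _+_; _*_; 0#)
  open WeightSystem D

  pairPoly : PolyCYℤ → PolyCYℤ → Carrier
  pairPoly P Q =
    foldr _+_ 0#
      (concatMap (λ { (α , j , k) →
         map (λ { (β , j′ , k′) →
                  fromℤ (α ℤ.* β) * pairShare (monoShare j k) (monoShare j′ k′) })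
             (terms Q) })
       (terms P))

-- Basis statement in C[c][y], with C replaced by an arbitrary commutative
-- ring K (p_n has integer coefficients).

module OverRing {a ℓ : Level} (K : CommutativeRing a ℓ) where
  open CommutativeRing K using (Carrier; _≈_; _+_; _*_; -_; 0#; 1#)

  module KC = PolyOps 0# _+_ _*_

  PolyC PolyCY : Set a
  PolyC  = List Carrier
  PolyCY = List PolyC

  module KCY = PolyOps [] KC.addP KC.mulP

  fromℕK : ℕ → Carrier
  fromℕK zero = 0#
  fromℕK (suc n) = 1# + fromℕK n

  fromℤK : ℤ → Carrier
  fromℤK (+ n) = fromℕK n
  fromℤK -[1+ n ] = - fromℕK (suc n)

  pK : ℕ → PolyCY
  pK n = map (map fromℤK) (pPoly n)

  -- coefficient of c^j y^k
  coeffCY : PolyCY → ℕ → ℕ → Carrier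
  coeffCY P k j = KC.coeff (KCY.coeff P k) j

  _≃_ : PolyCY → PolyCY → Set ℓ
  P ≃ Q = ∀ k j → coeffCY P k j ≈ coeffCY Q k j

  isZeroC : PolyC → Set ℓ
  isZeroC a = ∀ j → KC.coeff a j ≈ 0#

  combo : List PolyC → PolyCY
  combo as = go 0 as
    where
    go : ℕ → List PolyC → PolyCY
    go n []       = []
    go n (u ∷ us) = KCY.addP (KCY.mulP (u ∷ []) (pK n)) (go (suc n) us)

  IsBasis : Set (a ⊔ ℓ)
  IsBasis =
    (∀ (P : PolyCY) → ∃ λ (as : List PolyC) → combo as ≃ P)
    × (∀ (as : List PolyC) → combo as ≃ [] → ∀ n → isZeroC (KCY.coeff as n))

{-# OPTIONS --safe #-}

-- Write T u = Σ x_a u x_a. Reading the bridges of one share around the word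
-- of the other gives
--   ⟨y^k, y^l⟩ = Σ_b T^k(x_{b_1} ⋯ x_{b_l}) x_{b_l} ⋯ x_{b_1},
-- and symmetrically with T^l applied to the reversed word of the first share.
-- Hence ⟨p_n, y^l⟩ and ⟨y^l, p_n⟩ are governed by the operator p_n(T) applied
-- to words of length l. Filter the algebra by the length of words, with
-- coefficients commuting with the generators (so that c has degree 0). On the
-- words of length m, T acts as c − m(m+1)/2 modulo shorter words; so p_n(T)
-- lowers the filtration n times and kills all words of length l < n. No
-- division by 2 occurs, because T is computed directly rather than through
-- the adjoint Casimir element 2(c − T).
--
-- The basis property holds because p_n is monic of degree n in y.

module Submission where

open import Defs
open import Level using (Level; _⊔_)
open import Data.Bool using (Bool; true; false; if_then_else_)
open import Data.Empty using (⊥-elim)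
open import Data.Fin as Fin using (Fin; zero; suc)
open import Data.Integer as ℤ using (ℤ; +_; -[1+_])
import Data.Integer.Properties as ℤₚ
open import Data.List using (List; []; _∷_; _++_; _∷ʳ_; map; length; foldr; concatMap; reverse; upTo; applyUpTo; deduplicate; initLast; _∷ʳ′_)
import Data.List.Properties as Listₚ
open import Data.List.Membership.Propositional using (_∈_; _∉_)
open import Data.List.Membership.Propositional.Properties
  using (∈-∃++; ∈-++⁺ˡ; ∈-++⁺ʳ; ∈-++⁻; ∈-map⁻; ∈-upTo⁻; ∈-deduplicate⁺; ∈-deduplicate⁻)
open import Data.List.Relation.Binary.Disjoint.Propositional using (Disjoint)
open import Data.List.Relation.Binary.Permutation.Propositional as Perm using (_↭_; ↭-refl; ↭-sym; ↭-trans)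
import Data.List.Relation.Binary.Permutation.Propositional.Properties as Permₚ
open import Data.List.Relation.Unary.All as All using (All; []; _∷_)
import Data.List.Relation.Unary.All.Properties as Allₚ
open import Data.List.Relation.Unary.AllPairs using ([]; _∷_)
open import Data.List.Relation.Unary.Any using (here; there)
import Data.List.Relation.Unary.Any.Properties as Anyₚ
open import Data.List.Relation.Unary.Unique.DecPropositional.Properties using (deduplicate-!)
open import Data.List.Relation.Unary.Unique.Propositional using (Unique)
import Data.List.Relation.Unary.Unique.Propositional.Properties as Uniqueₚ
open import Data.Nat as ℕ using (ℕ; zero; suc; pred; _≤_; _<_; z≤n; s≤s)
import Data.Nat.Properties as ℕₚ
open import Data.Product using (_×_; _,_; ∃; proj₁; proj₂)
open import Data.Sign as Sign using (Sign)
open import Data.Sum using (_⊎_; inj₁; inj₂; [_,_]′)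
open import Data.Vec using (Vec; lookup)
open import Algebra.Bundles using (Ring; CommutativeRing; AbelianGroup)
open import Function using (_∘_)
open import Relation.Binary.Definitions using (tri<; tri≈; tri>)
open import Relation.Binary.PropositionalEquality as ≡ using (_≡_; _≢_)
import Relation.Binary.Reflection as Reflection
open import Relation.Nullary using (yes; no; does)

-- The eigenvalues come from a recursion. Moving x_b to the left out of T(x_b u) leaves an operator
-- S_b, and on words u of length m one has S_b u = -(m+1) x_b u modulo words of length at most m.
-- Passing from length m to m+1 thus adds -(m+1) to the eigenvalue, and T 1 = c, whence c -
-- m(m+1)/2. The delicate case is S_b(x_b u): the other two generators contribute their squares,
-- which add up to c - x_b^2, so the multiple of x_b^2 u comes out right only because c is given
-- degree 0.
--
-- The ring is arbitrary. It need not be generated by the x_a, and no linear independence of words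
-- is available. Hence there are no eigenvectors, only memberships in filtration steps, and c
-- commutes with the generators but perhaps not with everything. Symmetry of the form, which would
-- require moving the cut point, is replaced by the two expressions for the pairing: one serves n <
-- k, the other n > k.

-- The basis property: triangularity from monic polynomials

data Monic : ℕ → PolyCYℤ → Set where
  top  : Monic zero (((+ 1) ∷ []) ∷ [])
  lift : ∀ {n u P} → Monic n P → Monic (suc n) (u ∷ P)

-- The last entry stays literally the list of 1, without trailing zeros. So no comparison of
-- polynomials up to trailing zeros is needed, and monicity passes to every `K` by computation.
mulP-monic : ∀ {n P} f → Monic n P → Monic (suc n) (ZCY.mulP P (f ∷ ((+ 1) ∷ []) ∷ []))
mulP-monic f top = lift top
mulP-monic f (lift {P = P} m) with ZCY.mulP P (f ∷ ((+ 1) ∷ []) ∷ []) | mulP-monic f m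
-- The pattern `lift m′` exposes the head of the remaining product; the coefficient coming from `u`
-- is added to that head, and the tail is untouched.
... | _ | lift m′ = lift (lift m′)

pPoly-monic : ∀ n → Monic n (pPoly n)
pPoly-monic zero    = top
pPoly-monic (suc n) = mulP-monic _ (pPoly-monic n)

module Basis {a ℓ} (K : CommutativeRing a ℓ) where
  open OverRing K
  open CommutativeRing K renaming (Carrier to Kₒ)
  open import Algebra.Properties.Ring ring using (-‿distribˡ-*)
  open import Algebra.Properties.Group +-group using (ε⁻¹≈ε)
  open import Algebra.Properties.AbelianGroup +-abelianGroup using (⁻¹-∙-comm)
  open import Relation.Binary.Reasoning.Setoid setoid

  infix 4 _≋_
  _≋_ : PolyC → PolyC → Set ℓ
  p ≋ q = ∀ j → KC.coeff p j ≈ KC.coeff q j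

  infixl 7 _·ₚ_
  _·ₚ_ : PolyC → PolyCY → PolyCY
  u ·ₚ P = KCY.mulP (u ∷ []) P

  negC : PolyC → PolyC
  negC = map (λ u → - u)

  addC-coeff : ∀ p q j → KC.coeff (KC.addP p q) j ≈ KC.coeff p j + KC.coeff q j
  addC-coeff []      q       j       = sym (+-identityˡ _)
  addC-coeff (u ∷ p) []      j       = sym (+-identityʳ _)
  addC-coeff (u ∷ p) (v ∷ q) zero    = refl
  addC-coeff (u ∷ p) (v ∷ q) (suc j) = addC-coeff p q j

  addC-identityʳ : ∀ p → KC.addP p [] ≡ p
  addC-identityʳ []      = ≡.refl
  addC-identityʳ (u ∷ p) = ≡.refl

  addCY-coeff : ∀ P Q k → KCY.coeff (KCY.addP P Q) k ≡ KC.addP (KCY.coeff P k) (KCY.coeff Q k)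
  addCY-coeff []      Q       k       = ≡.refl
  addCY-coeff (u ∷ P) []      k       = ≡.sym (addC-identityʳ _)
  addCY-coeff (u ∷ P) (v ∷ Q) zero    = ≡.refl
  addCY-coeff (u ∷ P) (v ∷ Q) (suc k) = addCY-coeff P Q k

  coeffCY-add : ∀ P Q k j → coeffCY (KCY.addP P Q) k j ≈ coeffCY P k j + coeffCY Q k j
  coeffCY-add P Q k j = trans (reflexive (≡.cong (λ p → KC.coeff p j) (addCY-coeff P Q k)))
                              (addC-coeff (KCY.coeff P k) (KCY.coeff Q k) j)

  coeff-scale : ∀ u q j → KC.coeff (map (u *_) q) j ≈ u * KC.coeff q j
  coeff-scale u []      j       = sym (zeroʳ u)
  coeff-scale u (v ∷ q) zero    = refl
  coeff-scale u (v ∷ q) (suc j) = coeff-scale u q j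

  shift : (ℕ → Kₒ) → ℕ → Kₒ
  shift f zero    = 0#
  shift f (suc j) = f j

  coeff-mul : ∀ u p q j → KC.coeff (KC.mulP (u ∷ p) q) j
              ≈ u * KC.coeff q j + shift (KC.coeff (KC.mulP p q)) j
  coeff-mul u p q j = trans (addC-coeff (map (u *_) q) (0# ∷ KC.mulP p q) j)
                            (+-cong (coeff-scale u q j) (eq j))
    where
    eq : ∀ j → KC.coeff (0# ∷ KC.mulP p q) j ≈ shift (KC.coeff (KC.mulP p q)) j
    eq zero    = refl
    eq (suc j) = refl

  mul-zeroʳ : ∀ p q → isZeroC q → isZeroC (KC.mulP p q)
  mul-zeroʳ []      q z j = refl
  mul-zeroʳ (u ∷ p) q z j = begin
    KC.coeff (KC.mulP (u ∷ p) q) j                     ≈⟨ coeff-mul u p q j ⟩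
    u * KC.coeff q j + shift (KC.coeff (KC.mulP p q)) j  ≈⟨ +-cong (trans (*-congˡ (z j)) (zeroʳ u)) (sh j) ⟩
    0# + 0#                                            ≈⟨ +-identityˡ 0# ⟩
    0#                                                 ∎
    where
    sh : ∀ j → shift (KC.coeff (KC.mulP p q)) j ≈ 0#
    sh zero    = refl
    sh (suc j) = mul-zeroʳ p q z j

  mul-zeroˡ : ∀ p q → isZeroC p → isZeroC (KC.mulP p q)
  mul-zeroˡ []      q z j = refl
  mul-zeroˡ (u ∷ p) q z j = begin
    KC.coeff (KC.mulP (u ∷ p) q) j                     ≈⟨ coeff-mul u p q j ⟩
    u * KC.coeff q j + shift (KC.coeff (KC.mulP p q)) j  ≈⟨ +-cong (trans (*-congʳ (z 0)) (zeroˡ _)) (sh j) ⟩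
    0# + 0#                                            ≈⟨ +-identityˡ 0# ⟩
    0#                                                 ∎
    where
    sh : ∀ j → shift (KC.coeff (KC.mulP p q)) j ≈ 0#
    sh zero    = refl
    sh (suc j) = mul-zeroˡ p q (λ i → z (suc i)) j

  mul-neg : ∀ p q j → KC.coeff (KC.mulP (negC p) q) j ≈ - KC.coeff (KC.mulP p q) j
  mul-neg []      q j = sym ε⁻¹≈ε
  mul-neg (u ∷ p) q j = begin
    KC.coeff (KC.mulP (negC (u ∷ p)) q) j                          ≈⟨ coeff-mul (- u) (negC p) q j ⟩
    - u * KC.coeff q j + shift (KC.coeff (KC.mulP (negC p) q)) j     ≈⟨ +-cong (sym (-‿distribˡ-* u _)) (sh j) ⟩
    - (u * KC.coeff q j) + - shift (KC.coeff (KC.mulP p q)) j        ≈⟨ ⁻¹-∙-comm _ _ ⟩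
    - (u * KC.coeff q j + shift (KC.coeff (KC.mulP p q)) j)          ≈⟨ -‿cong (coeff-mul u p q j) ⟨
    - KC.coeff (KC.mulP (u ∷ p) q) j                               ∎
    where
    sh : ∀ j → shift (KC.coeff (KC.mulP (negC p) q)) j ≈ - shift (KC.coeff (KC.mulP p q)) j
    sh zero    = sym ε⁻¹≈ε
    sh (suc j) = mul-neg p q j

  mul-identityʳ : ∀ p → KC.mulP p ((1# + 0#) ∷ []) ≋ p
  mul-identityʳ []      j       = refl
  mul-identityʳ (u ∷ p) zero    = begin
    u * (1# + 0#) + 0#  ≈⟨ +-identityʳ _ ⟩
    u * (1# + 0#)       ≈⟨ *-congˡ (+-identityʳ 1#) ⟩
    u * 1#              ≈⟨ *-identityʳ u ⟩
    u                   ∎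
  mul-identityʳ (u ∷ p) (suc j) = mul-identityʳ p j

  coeffCY-scale : ∀ u P k j → coeffCY (u ·ₚ P) k j ≈ KC.coeff (KC.mulP u (KCY.coeff P k)) j
  coeffCY-scale u P k j = begin
    coeffCY (KCY.addP (map (KC.mulP u) P) ([] ∷ [])) k j
      ≈⟨ coeffCY-add (map (KC.mulP u) P) ([] ∷ []) k j ⟩
    coeffCY (map (KC.mulP u) P) k j + coeffCY ([] ∷ []) k j
      ≈⟨ +-cong (mapped P k) (null k) ⟩
    KC.coeff (KC.mulP u (KCY.coeff P k)) j + 0#
      ≈⟨ +-identityʳ _ ⟩
    KC.coeff (KC.mulP u (KCY.coeff P k)) j
      ∎
    where
    null : ∀ k → coeffCY ([] ∷ []) k j ≈ 0#
    null zero    = refl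
    null (suc k) = refl
    mapped : ∀ P k → coeffCY (map (KC.mulP u) P) k j ≈ KC.coeff (KC.mulP u (KCY.coeff P k)) j
    -- `KC.mulP u []` is a list of zeros as long as `u`, so it agrees with `[]` only
    -- coefficientwise.
    mapped []      k       = sym (mul-zeroʳ u [] (λ _ → refl) j)
    mapped (v ∷ P) zero    = refl
    mapped (v ∷ P) (suc k) = mapped P k

  -- The entry is `fromℤK (+ 1)` unfolded. It equals `1#` only up to `≈`, which is why
  -- `mul-identityʳ` is stated in this form.
  pK-top : ∀ n → KCY.coeff (pK n) n ≡ (1# + 0#) ∷ []
  pK-top n = go (pPoly-monic n)
    where
    go : ∀ {n P} → Monic n P → KCY.coeff (map (map fromℤK) P) n ≡ (1# + 0#) ∷ []
    go top      = ≡.refl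
    go (lift m) = go m

  pK-above : ∀ {n k} → n < k → KCY.coeff (pK n) k ≡ []
  pK-above {n} = go (pPoly-monic n)
    where
    go : ∀ {n k P} → Monic n P → n < k → KCY.coeff (map (map fromℤK) P) k ≡ []
    go top      (s≤s n<k) = ≡.refl
    go (lift m) (s≤s n<k) = go m n<k

  scale-top : ∀ u n j → coeffCY (u ·ₚ pK n) n j ≈ KC.coeff u j
  scale-top u n j = begin
    coeffCY (u ·ₚ pK n) n j                       ≈⟨ coeffCY-scale u (pK n) n j ⟩
    KC.coeff (KC.mulP u (KCY.coeff (pK n) n)) j   ≡⟨ ≡.cong (λ q → KC.coeff (KC.mulP u q) j) (pK-top n) ⟩
    KC.coeff (KC.mulP u ((1# + 0#) ∷ [])) j       ≈⟨ mul-identityʳ u j ⟩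
    KC.coeff u j                                  ∎

  scale-above : ∀ u {n k} j → n < k → coeffCY (u ·ₚ pK n) k j ≈ 0#
  scale-above u {n} {k} j n<k = begin
    coeffCY (u ·ₚ pK n) k j                       ≈⟨ coeffCY-scale u (pK n) k j ⟩
    KC.coeff (KC.mulP u (KCY.coeff (pK n) k)) j   ≡⟨ ≡.cong (λ q → KC.coeff (KC.mulP u q) j) (pK-above n<k) ⟩
    KC.coeff (KC.mulP u []) j                     ≈⟨ mul-zeroʳ u [] (λ _ → refl) j ⟩
    0#                                            ∎

  -- A named copy of the recursion inside `combo`, with the start index exposed for inductions.
  comboFrom : ℕ → List PolyC → PolyCY
  comboFrom n []       = []
  comboFrom n (u ∷ us) = KCY.addP (u ·ₚ pK n) (comboFrom (suc n) us)

  -- The local recursion of combo has no name here; abstracting its start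
  -- index lets unification supply it as the left-hand side of agrees.
  mutual
    combo≡comboFrom : ∀ us → combo us ≡ comboFrom 0 us
    combo≡comboFrom us with 0
    ... | n = agrees n us

    agrees : ∀ n us → _ ≡ comboFrom n us
    agrees n []       = ≡.refl
    agrees n (u ∷ us) = ≡.cong (KCY.addP (u ·ₚ pK n)) (agrees (suc n) us)

  -- The recursion peels off summands of low degree, whereas elimination starts with the summand of
  -- top degree; here that last summand is split off.
  comboFrom-∷ʳ : ∀ n us u k j → coeffCY (comboFrom n (us ∷ʳ u)) k j
                 ≈ coeffCY (comboFrom n us) k j + coeffCY (u ·ₚ pK (length us ℕ.+ n)) k j
  comboFrom-∷ʳ n []       u k j = trans (coeffCY-add (u ·ₚ pK n) [] k j) (+-comm _ _)
  comboFrom-∷ʳ n (v ∷ us) u k j = begin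
    coeffCY (KCY.addP (v ·ₚ pK n) (comboFrom (suc n) (us ∷ʳ u))) k j
      ≈⟨ coeffCY-add (v ·ₚ pK n) (comboFrom (suc n) (us ∷ʳ u)) k j ⟩
    coeffCY (v ·ₚ pK n) k j + coeffCY (comboFrom (suc n) (us ∷ʳ u)) k j
      ≈⟨ +-congˡ (comboFrom-∷ʳ (suc n) us u k j) ⟩
    coeffCY (v ·ₚ pK n) k j + (coeffCY (comboFrom (suc n) us) k j + coeffCY (u ·ₚ pK (length us ℕ.+ suc n)) k j)
      ≈⟨ +-assoc _ _ _ ⟨
    coeffCY (v ·ₚ pK n) k j + coeffCY (comboFrom (suc n) us) k j + coeffCY (u ·ₚ pK (length us ℕ.+ suc n)) k j
      ≈⟨ +-cong (sym (coeffCY-add (v ·ₚ pK n) (comboFrom (suc n) us) k j))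
                (reflexive (≡.cong (λ m → coeffCY (u ·ₚ pK m) k j) (ℕₚ.+-suc (length us) n))) ⟩
    coeffCY (comboFrom n (v ∷ us)) k j + coeffCY (u ·ₚ pK (suc (length us) ℕ.+ n)) k j
      ∎

  combo-∷ʳ : ∀ us u k j → coeffCY (combo (us ∷ʳ u)) k j
             ≈ coeffCY (combo us) k j + coeffCY (u ·ₚ pK (length us)) k j
  combo-∷ʳ us u k j rewrite combo≡comboFrom us | combo≡comboFrom (us ∷ʳ u) =
    trans (comboFrom-∷ʳ 0 us u k j)
          (+-congˡ (reflexive (≡.cong (λ m → coeffCY (u ·ₚ pK m) k j) (ℕₚ.+-identityʳ (length us)))))

  length-∷ʳ : ∀ (us : List PolyC) u → length (us ∷ʳ u) ≡ suc (length us)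
  length-∷ʳ us u = ≡.trans (Listₚ.length-++ us) (ℕₚ.+-comm (length us) 1)

  combo-above : ∀ N us → length us ≡ N → ∀ {k} j → N ≤ k → coeffCY (combo us) k j ≈ 0#
  combo-above N us len {k} j N≤k with initLast us
  combo-above N .[] len {k} j N≤k | [] = refl
  combo-above zero .(us ∷ʳ u) len j N≤k | us ∷ʳ′ u with () ← ≡.trans (≡.sym (length-∷ʳ us u)) len
  combo-above (suc N) .(us ∷ʳ u) len {k} j N≤k | us ∷ʳ′ u = begin
    coeffCY (combo (us ∷ʳ u)) k j                               ≈⟨ combo-∷ʳ us u k j ⟩
    coeffCY (combo us) k j + coeffCY (u ·ₚ pK (length us)) k j  ≈⟨ +-cong (combo-above N us len′ j (ℕₚ.<⇒≤ N≤k))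
                                                                          (scale-above u j (≡.subst (_< k) (≡.sym len′) N≤k)) ⟩
    0# + 0#                                                     ≈⟨ +-identityˡ 0# ⟩
    0#                                                          ∎
    where
    len′ : length us ≡ N
    len′ = ℕₚ.suc-injective (≡.trans (≡.sym (length-∷ʳ us u)) len)

  coeff-∷ʳ-last : ∀ us u → KCY.coeff (us ∷ʳ u) (length us) ≡ u
  coeff-∷ʳ-last []       u = ≡.refl
  coeff-∷ʳ-last (v ∷ us) u = coeff-∷ʳ-last us u

  coeff-∷ʳ-other : ∀ us u n → n ≢ length us → KCY.coeff (us ∷ʳ u) n ≡ KCY.coeff us n
  coeff-∷ʳ-other []       u zero    n≢ with () ← n≢ ≡.refl
  coeff-∷ʳ-other []       u (suc n) n≢ = ≡.refl
  coeff-∷ʳ-other (v ∷ us) u zero    n≢ = ≡.refl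
  coeff-∷ʳ-other (v ∷ us) u (suc n) n≢ = coeff-∷ʳ-other us u n (λ e → n≢ (≡.cong suc e))

  independent : ∀ N us → length us ≡ N → combo us ≃ [] → ∀ n → isZeroC (KCY.coeff us n)
  independent N us len eq n with initLast us
  independent N .[] len eq n | [] = λ _ → refl
  independent zero .(us ∷ʳ u) len eq n | us ∷ʳ′ u with () ← ≡.trans (≡.sym (length-∷ʳ us u)) len
  independent (suc N) .(us ∷ʳ u) len eq n | us ∷ʳ′ u = cases
    where
    len′ : length us ≡ N
    len′ = ℕₚ.suc-injective (≡.trans (≡.sym (length-∷ʳ us u)) len)
    u-zero : isZeroC u
    u-zero j = begin
      KC.coeff u j                                  ≈⟨ scale-top u (length us) j ⟨
      coeffCY (u ·ₚ pK (length us)) (length us) j   ≈⟨ +-identityˡ _ ⟨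
      0# + coeffCY (u ·ₚ pK (length us)) (length us) j
        ≈⟨ +-congʳ (combo-above (length us) us ≡.refl j ℕₚ.≤-refl) ⟨
      coeffCY (combo us) (length us) j + coeffCY (u ·ₚ pK (length us)) (length us) j
        ≈⟨ combo-∷ʳ us u (length us) j ⟨
      coeffCY (combo (us ∷ʳ u)) (length us) j       ≈⟨ eq (length us) j ⟩
      0#                                            ∎
    combo-us : combo us ≃ []
    combo-us k j = begin
      coeffCY (combo us) k j          ≈⟨ +-identityʳ _ ⟨
      coeffCY (combo us) k j + 0#
        ≈⟨ +-congˡ (trans (coeffCY-scale u (pK (length us)) k j)
                          (mul-zeroˡ u (KCY.coeff (pK (length us)) k) u-zero j)) ⟨
      coeffCY (combo us) k j + coeffCY (u ·ₚ pK (length us)) k j  ≈⟨ combo-∷ʳ us u k j ⟨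
      coeffCY (combo (us ∷ʳ u)) k j   ≈⟨ eq k j ⟩
      0#                              ∎
    cases : isZeroC (KCY.coeff (us ∷ʳ u) n)
    cases with n ℕ.≟ length us
    ... | yes ≡.refl rewrite coeff-∷ʳ-last us u = u-zero
    ... | no n≢ rewrite coeff-∷ʳ-other us u n n≢ = independent N us len′ combo-us n

  -- Division by a monic polynomial: subtracting the leading coefficient times `pK N` lowers the
  -- degree bound, with no inverse in `K` required.
  spans : ∀ N P → (∀ {k} j → N ≤ k → coeffCY P k j ≈ 0#) →
          ∃ λ us → length us ≡ N × combo us ≃ P
  spans zero    P deg = [] , ≡.refl , λ k j → sym (deg j z≤n)
  spans (suc N) P deg = us ∷ʳ u , ≡.trans (length-∷ʳ us u) (≡.cong suc len) , combo-eq
    where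
    u : PolyC
    u = KCY.coeff P N
    Q : PolyCY
    Q = KCY.addP P (negC u ·ₚ pK N)
    Q-coeff : ∀ k j → coeffCY Q k j ≈ coeffCY P k j + - coeffCY (u ·ₚ pK N) k j
    Q-coeff k j = begin
      coeffCY Q k j                                         ≈⟨ coeffCY-add P (negC u ·ₚ pK N) k j ⟩
      coeffCY P k j + coeffCY (negC u ·ₚ pK N) k j
        ≈⟨ +-congˡ (trans (coeffCY-scale (negC u) (pK N) k j) (mul-neg u (KCY.coeff (pK N) k) j)) ⟩
      coeffCY P k j + - KC.coeff (KC.mulP u (KCY.coeff (pK N) k)) j
        ≈⟨ +-congˡ (-‿cong (coeffCY-scale u (pK N) k j)) ⟨
      coeffCY P k j + - coeffCY (u ·ₚ pK N) k j             ∎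
    Q-deg : ∀ {k} j → N ≤ k → coeffCY Q k j ≈ 0#
    Q-deg {k} j N≤k with N ℕ.≟ k
    ... | yes ≡.refl = begin
      coeffCY Q N j                               ≈⟨ Q-coeff N j ⟩
      KC.coeff u j + - coeffCY (u ·ₚ pK N) N j    ≈⟨ +-congˡ (-‿cong (scale-top u N j)) ⟩
      KC.coeff u j + - KC.coeff u j               ≈⟨ -‿inverseʳ _ ⟩
      0#                                          ∎
    ... | no N≢k = begin
      coeffCY Q k j                               ≈⟨ Q-coeff k j ⟩
      coeffCY P k j + - coeffCY (u ·ₚ pK N) k j   ≈⟨ +-cong (deg j N<k) (-‿cong (scale-above u j N<k)) ⟩
      0# + - 0#                                   ≈⟨ -‿inverseʳ 0# ⟩
      0#                                          ∎
      where
      N<k : N < k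
      N<k = ℕₚ.≤∧≢⇒< N≤k N≢k
    rec = spans N Q Q-deg
    us = proj₁ rec
    len = proj₁ (proj₂ rec)
    combo-eq : combo (us ∷ʳ u) ≃ P
    combo-eq k j = begin
      coeffCY (combo (us ∷ʳ u)) k j                                 ≈⟨ combo-∷ʳ us u k j ⟩
      coeffCY (combo us) k j + coeffCY (u ·ₚ pK (length us)) k j
        ≈⟨ +-cong (trans (proj₂ (proj₂ rec) k j) (Q-coeff k j))
                  (reflexive (≡.cong (λ m → coeffCY (u ·ₚ pK m) k j) len)) ⟩
      coeffCY P k j + - coeffCY (u ·ₚ pK N) k j + coeffCY (u ·ₚ pK N) k j
        ≈⟨ +-assoc _ _ _ ⟩
      coeffCY P k j + (- coeffCY (u ·ₚ pK N) k j + coeffCY (u ·ₚ pK N) k j)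
        ≈⟨ +-congˡ (-‿inverseˡ _) ⟩
      coeffCY P k j + 0#                                            ≈⟨ +-identityʳ _ ⟩
      coeffCY P k j                                                 ∎

  coeff-beyond : ∀ P {k} → length P ≤ k → KCY.coeff P k ≡ []
  coeff-beyond []      _         = ≡.refl
  coeff-beyond (u ∷ P) (s≤s len) = coeff-beyond P len

  isBasis : IsBasis
  isBasis = spanning , λ us → independent (length us) us ≡.refl
    where
    spanning : ∀ P → ∃ λ us → combo us ≃ P
    spanning P with spans (length P) P (λ j len → reflexive (≡.cong (λ q → KC.coeff q j) (coeff-beyond P len)))
    ... | us , _ , eq = us , eq

-- Normalisation of noncommutative ring expressions

-- Deciding identities that hold in every (noncommutative) ring: an
-- expression is expanded into a sorted list of signed words, where
-- opposite occurrences of a word cancel.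
module NoncommutativeSolver {a ℓ} (A : Ring a ℓ) where
  open Ring A
  open import Algebra.Properties.Ring A using (-‿distribˡ-*; -‿distribʳ-*)
  open import Algebra.Properties.Group +-group using (⁻¹-involutive)
  open import Algebra.Properties.CommutativeSemigroup
    (AbelianGroup.commutativeSemigroup +-abelianGroup)
    using (x∙yz≈y∙xz)
  open import Relation.Binary.Reasoning.Setoid setoid

  infixl 6 _:+_ _:-_
  infixl 7 _:*_
  infix  8 :-_

  data Expr (n : ℕ) : Set where
    var       : Fin n → Expr n
    :0 :1     : Expr n
    :-_       : Expr n → Expr n
    _:+_ _:*_ : Expr n → Expr n → Expr n

  _:-_ : ∀ {n} → Expr n → Expr n → Expr n
  e :- f = e :+ :- f

  private
    Term : ℕ → Set
    Term n = Sign × List (Fin n)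

  -- Soundness does not depend on this order; it serves to bring equal expressions to the same list.
  before : ∀ {n} → List (Fin n) → List (Fin n) → Bool
  before []      _       = true
  before (_ ∷ _) []      = false
  before (i ∷ u) (j ∷ v) with i Fin.≟ j
  ... | yes _ = before u v
  ... | no  _ = does (i Fin.<? j)

  -- Integer coefficients appear as repeated copies of a word, all of one sign, since an opposite
  -- copy cancels on arrival.
  insert : ∀ {n} → Term n → List (Term n) → List (Term n)
  insert t []                    = t ∷ []
  insert (s , u) ((s′ , v) ∷ ts) with Listₚ.≡-dec Fin._≟_ u v | s Sign.≟ s′
  ... | yes _ | no  _ = ts
  ... | yes _ | yes _ = (s , u) ∷ (s′ , v) ∷ ts
  ... | no  _ | _     = if before u v then (s , u) ∷ (s′ , v) ∷ ts else (s′ , v) ∷ insert (s , u) ts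

  times : ∀ {n} → Term n → Term n → Term n
  times (s , u) (s′ , v) = s Sign.* s′ , u ++ v

  expand : ∀ {n} → Expr n → List (Term n)
  expand (var i)  = (Sign.+ , i ∷ []) ∷ []
  expand :0       = []
  expand :1       = (Sign.+ , []) ∷ []
  expand (:- e)   = map (times (Sign.- , [])) (expand e)
  expand (e :+ f) = expand e ++ expand f
  expand (e :* f) = concatMap (λ t → map (times t) (expand f)) (expand e)

  module _ {n} (ρ : Vec Carrier n) where
    ⟦_⟧ʷ : List (Fin n) → Carrier
    ⟦ u ⟧ʷ = foldr (λ i r → lookup ρ i * r) 1# u

    ⟦_⟧ᵗ : Term n → Carrier
    ⟦ Sign.+ , u ⟧ᵗ = ⟦ u ⟧ʷ
    ⟦ Sign.- , u ⟧ᵗ = - ⟦ u ⟧ʷ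

    ⟦_⟧ˢ : List (Term n) → Carrier
    ⟦ ts ⟧ˢ = foldr (λ t r → ⟦ t ⟧ᵗ + r) 0# ts

    ++-homoʷ : ∀ u v → ⟦ u ++ v ⟧ʷ ≈ ⟦ u ⟧ʷ * ⟦ v ⟧ʷ
    ++-homoʷ []      v = sym (*-identityˡ _)
    ++-homoʷ (i ∷ u) v = trans (*-congˡ (++-homoʷ u v)) (sym (*-assoc _ _ _))

    ++-homoˢ : ∀ ts us → ⟦ ts ++ us ⟧ˢ ≈ ⟦ ts ⟧ˢ + ⟦ us ⟧ˢ
    ++-homoˢ []       us = sym (+-identityˡ _)
    ++-homoˢ (t ∷ ts) us = trans (+-congˡ (++-homoˢ ts us)) (sym (+-assoc _ _ _))

    times-homo : ∀ t t′ → ⟦ times t t′ ⟧ᵗ ≈ ⟦ t ⟧ᵗ * ⟦ t′ ⟧ᵗ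
    times-homo (Sign.+ , u) (Sign.+ , v) = ++-homoʷ u v
    times-homo (Sign.+ , u) (Sign.- , v) = trans (-‿cong (++-homoʷ u v)) (-‿distribʳ-* _ _)
    times-homo (Sign.- , u) (Sign.+ , v) = trans (-‿cong (++-homoʷ u v)) (-‿distribˡ-* _ _)
    times-homo (Sign.- , u) (Sign.- , v) = begin
      ⟦ u ++ v ⟧ʷ                ≈⟨ ++-homoʷ u v ⟩
      ⟦ u ⟧ʷ * ⟦ v ⟧ʷ            ≈⟨ ⁻¹-involutive _ ⟨
      - - (⟦ u ⟧ʷ * ⟦ v ⟧ʷ)      ≈⟨ -‿cong (-‿distribˡ-* _ _) ⟩
      - (- ⟦ u ⟧ʷ * ⟦ v ⟧ʷ)      ≈⟨ -‿distribʳ-* _ _ ⟩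
      - ⟦ u ⟧ʷ * - ⟦ v ⟧ʷ        ∎

    map-times-homo : ∀ t ts → ⟦ map (times t) ts ⟧ˢ ≈ ⟦ t ⟧ᵗ * ⟦ ts ⟧ˢ
    map-times-homo t []        = sym (zeroʳ _)
    map-times-homo t (t′ ∷ ts) =
      trans (+-cong (times-homo t t′) (map-times-homo t ts)) (sym (distribˡ _ _ _))

    opposite-cancel : ∀ s s′ u → s ≡.≢ s′ → ⟦ s , u ⟧ᵗ + ⟦ s′ , u ⟧ᵗ ≈ 0#
    opposite-cancel Sign.+ Sign.+ u s≢ with () ← s≢ ≡.refl
    opposite-cancel Sign.+ Sign.- u s≢ = -‿inverseʳ _
    opposite-cancel Sign.- Sign.+ u s≢ = -‿inverseˡ _
    opposite-cancel Sign.- Sign.- u s≢ with () ← s≢ ≡.refl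

    insert-homo : ∀ t ts → ⟦ insert t ts ⟧ˢ ≈ ⟦ t ⟧ᵗ + ⟦ ts ⟧ˢ
    insert-homo t [] = refl
    insert-homo (s , u) ((s′ , v) ∷ ts) with Listₚ.≡-dec Fin._≟_ u v | s Sign.≟ s′
    ... | yes ≡.refl | no s≢ = begin
      ⟦ ts ⟧ˢ                                    ≈⟨ +-identityˡ _ ⟨
      0# + ⟦ ts ⟧ˢ                               ≈⟨ +-congʳ (opposite-cancel s s′ u s≢) ⟨
      ⟦ s , u ⟧ᵗ + ⟦ s′ , u ⟧ᵗ + ⟦ ts ⟧ˢ         ≈⟨ +-assoc _ _ _ ⟩
      ⟦ s , u ⟧ᵗ + (⟦ s′ , u ⟧ᵗ + ⟦ ts ⟧ˢ)       ∎
    ... | yes _ | yes _ = refl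
    ... | no _  | _ with before u v
    ...   | true  = refl
    ...   | false = trans (+-congˡ (insert-homo (s , u) ts)) (x∙yz≈y∙xz _ _ _)

    ⟦_⟧ : Expr n → Carrier
    ⟦ var i ⟧  = lookup ρ i
    ⟦ :0 ⟧     = 0#
    ⟦ :1 ⟧     = 1#
    ⟦ :- e ⟧   = - ⟦ e ⟧
    ⟦ e :+ f ⟧ = ⟦ e ⟧ + ⟦ f ⟧
    ⟦ e :* f ⟧ = ⟦ e ⟧ * ⟦ f ⟧

    product-homo : ∀ ts us → ⟦ concatMap (λ t → map (times t) us) ts ⟧ˢ ≈ ⟦ ts ⟧ˢ * ⟦ us ⟧ˢ
    product-homo []       us = sym (zeroˡ _)
    product-homo (t ∷ ts) us = begin
      ⟦ map (times t) us ++ concatMap (λ t → map (times t) us) ts ⟧ˢ   ≈⟨ ++-homoˢ (map (times t) us) _ ⟩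
      ⟦ map (times t) us ⟧ˢ + ⟦ concatMap (λ t → map (times t) us) ts ⟧ˢ
        ≈⟨ +-cong (map-times-homo t us) (product-homo ts us) ⟩
      ⟦ t ⟧ᵗ * ⟦ us ⟧ˢ + ⟦ ts ⟧ˢ * ⟦ us ⟧ˢ                            ≈⟨ distribʳ _ _ _ ⟨
      (⟦ t ⟧ᵗ + ⟦ ts ⟧ˢ) * ⟦ us ⟧ˢ                                    ∎

    expand-correct : ∀ e → ⟦ expand e ⟧ˢ ≈ ⟦ e ⟧
    expand-correct (var i)  = trans (+-identityʳ _) (*-identityʳ _)
    expand-correct :0       = refl
    expand-correct :1       = +-identityʳ _
    expand-correct (:- e)   = begin
      ⟦ map (times (Sign.- , [])) (expand e) ⟧ˢ  ≈⟨ map-times-homo _ (expand e) ⟩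
      - 1# * ⟦ expand e ⟧ˢ                       ≈⟨ -‿distribˡ-* _ _ ⟨
      - (1# * ⟦ expand e ⟧ˢ)                     ≈⟨ -‿cong (trans (*-identityˡ _) (expand-correct e)) ⟩
      - ⟦ e ⟧                                    ∎
    expand-correct (e :+ f) =
      trans (++-homoˢ (expand e) (expand f)) (+-cong (expand-correct e) (expand-correct f))
    expand-correct (e :* f) =
      trans (product-homo (expand e) (expand f)) (*-cong (expand-correct e) (expand-correct f))

  ⟦_⇓⟧ : ∀ {n} → Expr n → Vec Carrier n → Carrier
  ⟦ e ⇓⟧ ρ = ⟦_⟧ˢ ρ (foldr insert [] (expand e))

  correct : ∀ {n} (e : Expr n) ρ → ⟦ e ⇓⟧ ρ ≈ ⟦_⟧ ρ e
  correct e ρ = trans (sort-correct (expand e)) (expand-correct ρ e)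
    where
    sort-correct : ∀ ts → ⟦_⟧ˢ ρ (foldr insert [] ts) ≈ ⟦_⟧ˢ ρ ts
    sort-correct []       = refl
    sort-correct (t ∷ ts) = trans (insert-homo ρ t (foldr insert [] ts)) (+-congˡ (sort-correct ts))

  open Reflection setoid var (λ e ρ → ⟦_⟧ ρ e) ⟦_⇓⟧ correct public using (solve; _⊜_)

-- The filtration by word length and the action of `T` on it

next-cases : ∀ b e → (e ≡ b) ⊎ (e ≡ next b) ⊎ (e ≡ next (next b))
next-cases zero             zero             = inj₁ ≡.refl
next-cases zero             (suc zero)       = inj₂ (inj₁ ≡.refl)
next-cases zero             (suc (suc zero)) = inj₂ (inj₂ ≡.refl)
next-cases (suc zero)       zero             = inj₂ (inj₂ ≡.refl)
next-cases (suc zero)       (suc zero)       = inj₁ ≡.refl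
next-cases (suc zero)       (suc (suc zero)) = inj₂ (inj₁ ≡.refl)
next-cases (suc (suc zero)) zero             = inj₂ (inj₁ ≡.refl)
next-cases (suc (suc zero)) (suc zero)       = inj₂ (inj₂ ≡.refl)
next-cases (suc (suc zero)) (suc (suc zero)) = inj₁ ≡.refl

module Filtration {a ℓ} {A : Ring a ℓ} (D : Sl2Datum A) where
  open Ring A hiding (zero)
  open Sl2Datum D
  open WeightSystem D
  open NoncommutativeSolver A
  open import Algebra.Properties.Ring A using (-1*x≈-x)
  open import Relation.Binary.Reasoning.Setoid setoid

  Σ₃ : (Fin 3 → Carrier) → Carrier
  Σ₃ f = f zero + (f (suc zero) + f (suc (suc zero)))

  cyclic : ∀ f b → Σ₃ f ≈ f b + (f (next b) + f (next (next b)))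
  cyclic f zero             = refl
  cyclic f (suc zero)       = solve 3 (λ u v w → u :+ (v :+ w) ⊜ v :+ (w :+ u)) refl _ _ _
  cyclic f (suc (suc zero)) = solve 3 (λ u v w → u :+ (v :+ w) ⊜ w :+ (u :+ v)) refl _ _ _

  c : Carrier
  c = Σ₃ λ i → x i * x i

  T : Carrier → Carrier
  T u = Σ₃ λ i → x i * u * x i

  -- The b-th component of ι (L × R), for L and R the vectors of left and
  -- right multiplications by the generators.
  S : Fin 3 → Carrier → Carrier
  S b u = ι * (x (next b) * u * x (next (next b)) - x (next (next b)) * u * x (next b))

  swap-bracket : ∀ {u v w} → u - v ≈ w → v ≈ u - w
  swap-bracket {u} {v} {w} eq = begin
    v            ≈⟨ solve 2 (λ u v → v ⊜ u :- (u :- v)) refl u v ⟩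
    u - (u - v)  ≈⟨ +-congˡ (-‿cong eq) ⟩
    u - w        ∎

  swap-bracket′ : ∀ {u v w} → u - v ≈ w → u ≈ v + w
  swap-bracket′ {u} {v} {w} eq = begin
    u            ≈⟨ solve 2 (λ u v → u ⊜ v :+ (u :- v)) refl u v ⟩
    v + (u - v)  ≈⟨ +-congˡ eq ⟩
    v + w        ∎

  bracket₂ : ∀ b → x (next b) * x (next (next b)) - x (next (next b)) * x (next b) ≈ ι * x b
  bracket₂ zero             = bracket (suc zero)
  bracket₂ (suc zero)       = bracket (suc (suc zero))
  bracket₂ (suc (suc zero)) = bracket zero

  bracket₃ : ∀ b → x (next (next b)) * x b - x b * x (next (next b)) ≈ ι * x (next b)
  bracket₃ zero             = bracket (suc (suc zero))
  bracket₃ (suc zero)       = bracket zero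
  bracket₃ (suc (suc zero)) = bracket (suc zero)

  -- The relations are invariant under cyclic rotation, so each computation is done once, for the
  -- triple starting at `b`. To `solve`, `ι` is one more noncommuting variable; hence the chains
  -- alternate between ring identities and explicit uses of a bracket, of `ι-central` or of `ι²`.
  module Triple (b : Fin 3) where
    p q r : Carrier
    p = x b
    q = x (next b)
    r = x (next (next b))

    qp : q * p ≈ p * q - ι * r
    qp = swap-bracket (bracket b)

    rp : r * p ≈ p * r + ι * q
    rp = swap-bracket′ (bracket₃ b)

    qr : q * r ≈ r * q + ι * p
    qr = swap-bracket′ (bracket₂ b)

    rq : r * q ≈ q * r - ι * p
    rq = swap-bracket (bracket₂ b)

    T-expand : ∀ u → T u ≈ p * u * p + (q * u * q + r * u * r)
    T-expand u = cyclic (λ i → x i * u * x i) b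

    c-expand : c ≈ p * p + (q * q + r * r)
    c-expand = cyclic (λ i → x i * x i) b

    -- Moving `p` to the left through `q * q` leaves `- ι * (q * r + r * q)`, and through `r * r`
    -- the opposite.
    c-comm : c * p ≈ p * c
    c-comm = begin
      c * p                                   ≈⟨ *-congʳ c-expand ⟩
      (p * p + (q * q + r * r)) * p
        ≈⟨ solve 3 (λ p q r → (p :* p :+ (q :* q :+ r :* r)) :* p
                            ⊜ p :* p :* p :+ (q :* (q :* p) :+ r :* (r :* p))) refl p q r ⟩
      p * p * p + (q * (q * p) + r * (r * p))
        ≈⟨ +-congˡ (+-cong (*-congˡ qp) (*-congˡ rp)) ⟩
      p * p * p + (q * (p * q - ι * r) + r * (p * r + ι * q))
        ≈⟨ solve 4 (λ i p q r → p :* p :* p :+ (q :* (p :* q :- i :* r) :+ r :* (p :* r :+ i :* q))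
                              ⊜ p :* p :* p :+ (q :* p :* q :+ r :* p :* r :+ (r :* i :* q :- q :* i :* r)))
                 refl ι p q r ⟩
      p * p * p + (q * p * q + r * p * r + (r * ι * q - q * ι * r))
        ≈⟨ +-congˡ (+-cong (+-cong (*-congʳ qp) (*-congʳ rp))
                           (+-cong (*-congʳ (sym (ι-central r))) (-‿cong (*-congʳ (sym (ι-central q)))))) ⟩
      p * p * p + ((p * q - ι * r) * q + (p * r + ι * q) * r + (ι * r * q - ι * q * r))
        ≈⟨ solve 4 (λ i p q r → p :* p :* p :+ ((p :* q :- i :* r) :* q :+ (p :* r :+ i :* q) :* r
                                                :+ (i :* r :* q :- i :* q :* r))
                              ⊜ p :* (p :* p :+ (q :* q :+ r :* r))) refl ι p q r ⟩
      p * (p * p + (q * q + r * r))           ≈⟨ *-congˡ c-expand ⟨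
      p * c                                   ∎

    -- `S b` is exactly the failure of `T` to commute with left multiplication by `p`: it collects
    -- the corrections from `qp` and `rp`.
    T-step : ∀ u → T (p * u) ≈ p * T u + S b u
    T-step u = begin
      T (p * u)                                                ≈⟨ T-expand (p * u) ⟩
      p * (p * u) * p + (q * (p * u) * q + r * (p * u) * r)
        ≈⟨ solve 4 (λ p q r u → p :* (p :* u) :* p :+ (q :* (p :* u) :* q :+ r :* (p :* u) :* r)
                              ⊜ p :* (p :* u) :* p :+ (q :* p :* u :* q :+ r :* p :* u :* r)) refl p q r u ⟩
      p * (p * u) * p + (q * p * u * q + r * p * u * r)
        ≈⟨ +-congˡ (+-cong (*-congʳ (*-congʳ qp)) (*-congʳ (*-congʳ rp))) ⟩
      p * (p * u) * p + ((p * q - ι * r) * u * q + (p * r + ι * q) * u * r)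
        ≈⟨ solve 5 (λ i p q r u → p :* (p :* u) :* p :+ ((p :* q :- i :* r) :* u :* q :+ (p :* r :+ i :* q) :* u :* r)
                              ⊜ p :* (p :* u :* p :+ (q :* u :* q :+ r :* u :* r))
                                :+ i :* (q :* u :* r :- r :* u :* q)) refl ι p q r u ⟩
      p * (p * u * p + (q * u * q + r * u * r)) + S b u        ≈⟨ +-congʳ (*-congˡ (T-expand u)) ⟨
      p * T u + S b u                                          ∎

    -- In this and the next two lemmas the bracket supplies a second `ι`, so that by `ι²` the
    -- correction terms carry only signs.
    S-step-p : ∀ u → S b (p * u) ≈ p * S b u + (q * u * q + r * u * r)
    S-step-p u = begin
      ι * (q * (p * u) * r - r * (p * u) * q)
        ≈⟨ solve 5 (λ i p q r u → i :* (q :* (p :* u) :* r :- r :* (p :* u) :* q)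
                              ⊜ i :* (q :* p :* u :* r :- r :* p :* u :* q)) refl ι p q r u ⟩
      ι * (q * p * u * r - r * p * u * q)
        ≈⟨ *-congˡ (+-cong (*-congʳ (*-congʳ qp)) (-‿cong (*-congʳ (*-congʳ rp)))) ⟩
      ι * ((p * q - ι * r) * u * r - (p * r + ι * q) * u * q)
        ≈⟨ solve 5 (λ i p q r u → i :* ((p :* q :- i :* r) :* u :* r :- (p :* r :+ i :* q) :* u :* q)
                              ⊜ i :* p :* (q :* u :* r :- r :* u :* q)
                                :- i :* i :* (q :* u :* q :+ r :* u :* r)) refl ι p q r u ⟩
      ι * p * (q * u * r - r * u * q) - ι * ι * (q * u * q + r * u * r)
        ≈⟨ +-cong (*-congʳ (ι-central p)) (-‿cong (*-congʳ ι²)) ⟩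
      p * ι * (q * u * r - r * u * q) - - 1# * (q * u * q + r * u * r)
        ≈⟨ solve 5 (λ i p q r u → p :* i :* (q :* u :* r :- r :* u :* q) :- :- :1 :* (q :* u :* q :+ r :* u :* r)
                              ⊜ p :* (i :* (q :* u :* r :- r :* u :* q)) :+ (q :* u :* q :+ r :* u :* r)) refl ι p q r u ⟩
      p * S b u + (q * u * q + r * u * r)  ∎

    S-step-q : ∀ u → S b (q * u) ≈ q * S b u - p * u * q
    S-step-q u = begin
      ι * (q * (q * u) * r - r * (q * u) * q)
        ≈⟨ solve 4 (λ i q r u → i :* (q :* (q :* u) :* r :- r :* (q :* u) :* q)
                              ⊜ i :* (q :* q :* u :* r :- r :* q :* u :* q)) refl ι q r u ⟩
      ι * (q * q * u * r - r * q * u * q)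
        ≈⟨ *-congˡ (+-congˡ (-‿cong (*-congʳ (*-congʳ rq)))) ⟩
      ι * (q * q * u * r - (q * r - ι * p) * u * q)
        ≈⟨ solve 5 (λ i p q r u → i :* (q :* q :* u :* r :- (q :* r :- i :* p) :* u :* q)
                              ⊜ i :* q :* (q :* u :* r :- r :* u :* q) :+ i :* i :* (p :* u :* q)) refl ι p q r u ⟩
      ι * q * (q * u * r - r * u * q) + ι * ι * (p * u * q)
        ≈⟨ +-cong (*-congʳ (ι-central q)) (*-congʳ ι²) ⟩
      q * ι * (q * u * r - r * u * q) + - 1# * (p * u * q)
        ≈⟨ solve 5 (λ i p q r u → q :* i :* (q :* u :* r :- r :* u :* q) :+ :- :1 :* (p :* u :* q)
                              ⊜ q :* (i :* (q :* u :* r :- r :* u :* q)) :- p :* u :* q) refl ι p q r u ⟩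
      q * S b u - p * u * q  ∎

    S-step-r : ∀ u → S b (r * u) ≈ r * S b u - p * u * r
    S-step-r u = begin
      ι * (q * (r * u) * r - r * (r * u) * q)
        ≈⟨ solve 4 (λ i q r u → i :* (q :* (r :* u) :* r :- r :* (r :* u) :* q)
                              ⊜ i :* (q :* r :* u :* r :- r :* r :* u :* q)) refl ι q r u ⟩
      ι * (q * r * u * r - r * r * u * q)
        ≈⟨ *-congˡ (+-congʳ (*-congʳ (*-congʳ qr))) ⟩
      ι * ((r * q + ι * p) * u * r - r * r * u * q)
        ≈⟨ solve 5 (λ i p q r u → i :* ((r :* q :+ i :* p) :* u :* r :- r :* r :* u :* q)
                              ⊜ i :* r :* (q :* u :* r :- r :* u :* q) :+ i :* i :* (p :* u :* r)) refl ι p q r u ⟩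
      ι * r * (q * u * r - r * u * q) + ι * ι * (p * u * r)
        ≈⟨ +-cong (*-congʳ (ι-central r)) (*-congʳ ι²) ⟩
      r * ι * (q * u * r - r * u * q) + - 1# * (p * u * r)
        ≈⟨ solve 5 (λ i p q r u → r :* i :* (q :* u :* r :- r :* u :* q) :+ :- :1 :* (p :* u :* r)
                              ⊜ r :* (i :* (q :* u :* r :- r :* u :* q)) :- p :* u :* r) refl ι p q r u ⟩
      r * S b u - p * u * r  ∎

    S-one : S b 1# + p ≈ 0#
    S-one = begin
      ι * (q * 1# * r - r * 1# * q) + p
        ≈⟨ solve 4 (λ i p q r → i :* (q :* :1 :* r :- r :* :1 :* q) :+ p ⊜ i :* (q :* r :- r :* q) :+ p) refl ι p q r ⟩
      ι * (q * r - r * q) + p  ≈⟨ +-congʳ (*-congˡ (bracket₂ b)) ⟩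
      ι * (ι * p) + p          ≈⟨ +-congʳ (trans (sym (*-assoc _ _ _)) (*-congʳ ι²)) ⟩
      - 1# * p + p             ≈⟨ solve 1 (λ p → :- :1 :* p :+ p ⊜ :0) refl p ⟩
      0#                       ∎

  -- This is all that the coefficients of `F` need, and what can be said of `c`. Integers and `ι`
  -- satisfy the stronger `Central`.
  Scalar : Carrier → Set ℓ
  Scalar s = ∀ i → s * x i ≈ x i * s

  Central : Carrier → Set (a ⊔ ℓ)
  Central s = ∀ u → s * u ≈ u * s

  c-scalar : Scalar c
  c-scalar = Triple.c-comm

  central-scalar : ∀ {s} → Central s → Scalar s
  central-scalar sc i = sc (x i)

  -1-central : Central (- 1#)
  -1-central = solve 1 (λ u → :- :1 :* u ⊜ u :* :- :1) refl

  fromℕ-central : ∀ n → Central (fromℕ n)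
  fromℕ-central zero    u = trans (zeroˡ u) (sym (zeroʳ u))
  fromℕ-central (suc n) u = begin
    (1# + fromℕ n) * u  ≈⟨ solve 2 (λ n u → (:1 :+ n) :* u ⊜ u :+ n :* u) refl (fromℕ n) u ⟩
    u + fromℕ n * u     ≈⟨ +-congˡ (fromℕ-central n u) ⟩
    u + u * fromℕ n     ≈⟨ solve 2 (λ n u → u :+ u :* n ⊜ u :* (:1 :+ n)) refl (fromℕ n) u ⟩
    u * (1# + fromℕ n)  ∎

  x-scalar-swap : ∀ {s} → Scalar s → ∀ i u → x i * (s * u) ≈ s * (x i * u)
  x-scalar-swap {s} sc i u = begin
    x i * (s * u)  ≈⟨ *-assoc _ _ _ ⟨
    x i * s * u    ≈⟨ *-congʳ (sc i) ⟨
    s * x i * u    ≈⟨ *-assoc _ _ _ ⟩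
    s * (x i * u)  ∎

  -- Homogeneity over the coefficients allowed in `F` is what an induction over `F` requires of a
  -- map.
  record Linear (G : Carrier → Carrier) : Set (a ⊔ ℓ) where
    field
      cong   : ∀ {u v} → u ≈ v → G u ≈ G v
      +-homo : ∀ u v → G (u + v) ≈ G u + G v
      *-homo : ∀ {s} → Scalar s → ∀ u → G (s * u) ≈ s * G u

    0-homo : G 0# ≈ 0#
    0-homo = begin
      G 0#         ≈⟨ cong (zeroˡ 0#) ⟨
      G (0# * 0#)  ≈⟨ *-homo (λ i → trans (zeroˡ _) (sym (zeroʳ _))) 0# ⟩
      0# * G 0#    ≈⟨ zeroˡ _ ⟩
      0#           ∎

  x*-linear : ∀ i → Linear (λ u → x i * u)
  x*-linear i = record { cong = *-congˡ ; +-homo = distribˡ (x i) ; *-homo = λ sc u → x-scalar-swap sc i u }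

  *-linear : ∀ v → Linear (λ u → u * v)
  *-linear v = record { cong = *-congʳ ; +-homo = distribʳ v ; *-homo = λ sc u → *-assoc _ _ _ }

  central*-linear : ∀ {t} → Central t → Linear (λ u → t * u)
  central*-linear {t} tc = record
    { cong = *-congˡ ; +-homo = distribˡ t
    ; *-homo = λ {s} sc u → begin
        t * (s * u)  ≈⟨ *-assoc _ _ _ ⟨
        t * s * u    ≈⟨ *-congʳ (tc s) ⟩
        s * t * u    ≈⟨ *-assoc _ _ _ ⟩
        s * (t * u)  ∎ }

  infixr 9 _∘ˡ_
  _∘ˡ_ : ∀ {G H} → Linear G → Linear H → Linear (λ u → G (H u))
  g ∘ˡ h = record
    { cong   = λ e → Linear.cong g (Linear.cong h e)
    ; +-homo = λ u v → trans (Linear.cong g (Linear.+-homo h u v)) (Linear.+-homo g _ _)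
    ; *-homo = λ sc u → trans (Linear.cong g (Linear.*-homo h sc u)) (Linear.*-homo g sc _) }

  infixl 6 _+ˡ_ _-ˡ_
  _+ˡ_ : ∀ {G H} → Linear G → Linear H → Linear (λ u → G u + H u)
  _+ˡ_ {G} {H} g h = record
    { cong   = λ e → +-cong (Linear.cong g e) (Linear.cong h e)
    ; +-homo = λ u v → trans (+-cong (Linear.+-homo g u v) (Linear.+-homo h u v))
        (solve 4 (λ a b c d → a :+ b :+ (c :+ d) ⊜ a :+ c :+ (b :+ d)) refl (G u) (G v) (H u) (H v))
    ; *-homo = λ {s} sc u → trans (+-cong (Linear.*-homo g sc u) (Linear.*-homo h sc u)) (sym (distribˡ s _ _)) }

  -ˡ_ : ∀ {G} → Linear G → Linear (λ u → - G u)
  -ˡ_ {G} g = record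
    { cong   = λ e → -‿cong (Linear.cong g e)
    ; +-homo = λ u v → trans (-‿cong (Linear.+-homo g u v))
        (solve 2 (λ a b → :- (a :+ b) ⊜ :- a :+ :- b) refl (G u) (G v))
    ; *-homo = λ {s} sc u → trans (-‿cong (Linear.*-homo g sc u))
        (solve 2 (λ s a → :- (s :* a) ⊜ s :* :- a) refl s (G u)) }

  _-ˡ_ : ∀ {G H} → Linear G → Linear H → Linear (λ u → G u - H u)
  g -ˡ h = g +ˡ (-ˡ h)

  sandwich-linear : ∀ i j → Linear (λ u → x i * u * x j)
  sandwich-linear i j = *-linear (x j) ∘ˡ x*-linear i

  T-linear : Linear T
  T-linear = sandwich-linear _ _ +ˡ (sandwich-linear _ _ +ˡ sandwich-linear _ _)

  S-linear : ∀ b → Linear (S b)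
  S-linear b = central*-linear ι-central ∘ˡ (sandwich-linear _ _ -ˡ sandwich-linear _ _)

  xx*-linear : ∀ i → Linear (λ u → x i * x i * u)
  xx*-linear i = record
    { cong = *-congˡ ; +-homo = distribˡ _
    ; *-homo = λ {s} sc u → begin
        x i * x i * (s * u)    ≈⟨ *-assoc _ _ _ ⟩
        x i * (x i * (s * u))  ≈⟨ Linear.*-homo (x*-linear i ∘ˡ x*-linear i) sc u ⟩
        s * (x i * (x i * u))  ≈⟨ *-congˡ (*-assoc _ _ _) ⟨
        s * (x i * x i * u)    ∎ }

  -- `c` need not be central, so `central*-linear` does not apply. A scalar passes through the
  -- square of each generator, hence through their sum.
  c*-linear : Linear (λ u → c * u)
  c*-linear = record
    { cong = *-congˡ ; +-homo = distribˡ c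
    ; *-homo = λ {s} sc u → begin
        c * (s * u)                  ≈⟨ split (s * u) ⟩
        Σ₃ (λ i → x i * x i * (s * u)) ≈⟨ Linear.*-homo (xx*-linear _ +ˡ (xx*-linear _ +ˡ xx*-linear _)) sc u ⟩
        s * Σ₃ (λ i → x i * x i * u)   ≈⟨ *-congˡ (split u) ⟨
        s * (c * u)                  ∎ }
    where
    split : ∀ u → c * u ≈ Σ₃ (λ i → x i * x i * u)
    split u = trans (distribʳ u _ _) (+-congˡ (distribʳ u _ _))

  -- F d is the span of the words of length less than d in the generators,
  -- over the elements commuting with the generators.
  data F : ℕ → Carrier → Set (a ⊔ ℓ) where
    resp  : ∀ {d u v} → u ≈ v → F d u → F d v
    zero∈ : ∀ {d} → F d 0#
    add∈  : ∀ {d u v} → F d u → F d v → F d (u + v)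
    mul∈  : ∀ {d s u} → Scalar s → F d u → F d (s * u)
    one∈  : F 1 1#
    x∈    : ∀ {d u} i → F d u → F (suc d) (x i * u)
    up∈   : ∀ {d u} → F d u → F (suc d) u

  neg∈ : ∀ {d u} → F d u → F d (- u)
  neg∈ f = resp (-1*x≈-x _) (mul∈ (central-scalar -1-central) f)

  sub∈ : ∀ {d u v} → F d u → F d v → F d (u - v)
  sub∈ f g = add∈ f (neg∈ g)

  F-zero : ∀ {u} → F 0 u → u ≈ 0#
  F-zero (resp eq f) = trans (sym eq) (F-zero f)
  F-zero zero∈       = refl
  F-zero (add∈ f g)  = trans (+-cong (F-zero f) (F-zero g)) (+-identityˡ 0#)
  F-zero (mul∈ _ f)  = trans (*-congˡ (F-zero f)) (zeroʳ _)

  -- Induction over `F` for a linear map that may depend on the bound `d`, as the correction terms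
  -- for `S b` and `T` do. Linearity settles sums and coefficients. The weakening `up∈` remains as a
  -- genuine case, because it changes the map.
  F-map : (e : ℕ → ℕ) (G : ℕ → Carrier → Carrier) → (∀ d → Linear (G d)) →
          F (e 1) (G 1 1#) →
          (∀ {d u} i → F d u → F (e d) (G d u) → F (e (suc d)) (G (suc d) (x i * u))) →
          (∀ {d u} → F d u → F (e d) (G d u) → F (e (suc d)) (G (suc d) u)) →
          ∀ {d u} → F d u → F (e d) (G d u)
  F-map e G lin G-one G-x G-up = go
    where
    go : ∀ {d u} → F d u → F (e d) (G d u)
    go (resp eq f)     = resp (Linear.cong (lin _) eq) (go f)
    go zero∈           = resp (sym (Linear.0-homo (lin _))) zero∈
    go (add∈ f g)      = resp (sym (Linear.+-homo (lin _) _ _)) (add∈ (go f) (go g))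
    go (mul∈ sc f)     = resp (sym (Linear.*-homo (lin _) sc _)) (mul∈ sc (go f))
    go one∈            = G-one
    go (x∈ i f)        = G-x i f (go f)
    go (up∈ f)         = G-up f (go f)

  -- A bracket of two generators is 0 or, up to sign, `ι` times a generator, so it counts as one
  -- letter instead of two.
  bracket∈ : ∀ {d u} j i → F d u → F (suc d) ((x j * x i - x i * x j) * u)
  bracket∈ {d} {u} j i f with next-cases j i
  ... | inj₁ ≡.refl = resp (solve 2 (λ p u → :0 ⊜ (p :* p :- p :* p) :* u) refl (x j) u) zero∈
  ... | inj₂ (inj₁ ≡.refl) =
    resp (trans (sym (*-assoc _ _ _)) (*-congʳ (sym (bracket j)))) (mul∈ (central-scalar ι-central) (x∈ _ f))
  ... | inj₂ (inj₂ ≡.refl) =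
    resp (begin
      - (ι * (x (next j) * u))                           ≈⟨ -‿cong (*-assoc _ _ _) ⟨
      - (ι * x (next j) * u)                             ≈⟨ -‿cong (*-congʳ (bracket₃ j)) ⟨
      - ((x i * x j - x j * x i) * u)
        ≈⟨ solve 3 (λ p r u → :- ((r :* p :- p :* r) :* u) ⊜ (p :* r :- r :* p) :* u) refl (x j) (x i) u ⟩
      (x j * x i - x i * x j) * u                        ∎)
      (neg∈ (mul∈ (central-scalar ι-central) (x∈ _ f)))

  -- `F` grows by letters on the left only, while `T` and `S b` also multiply on the right. A right
  -- factor can be moved to the left at the price of a term no longer than `u`: the commutator with
  -- `x i` is a derivation, and brackets of generators are single letters.
  commutator∈ : ∀ i {d u} → F d u → F d (u * x i - x i * u)
  commutator∈ i = F-map (λ d → d) (λ _ u → u * x i - x i * u)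
    (λ _ → *-linear (x i) -ˡ x*-linear i)
    (resp (solve 1 (λ p → :0 ⊜ :1 :* p :- p :* :1) refl (x i)) zero∈)
    (λ {d} {u} j f g → resp
      (solve 3 (λ p q u → q :* (u :* p :- p :* u) :+ (q :* p :- p :* q) :* u ⊜ q :* u :* p :- p :* (q :* u)) refl (x i) (x j) u)
      (add∈ (x∈ j g) (bracket∈ j i f)))
    (λ f g → up∈ g)

  -- The source of the triangular numbers: each new letter increases by one the multiple of
  -- `x b * u` that cancels `S b u` in top degree. The multiple is `d` because the longest words in
  -- `F d` have `d - 1` letters and `S b 1#` is already `- x b`.
  S-top : ∀ b {d u} → F d u → F d (S b u + fromℕ d * (x b * u))
  S-top b = F-map (λ d → d) (λ d u → S b u + fromℕ d * (x b * u))
    (λ d → S-linear b +ˡ (central*-linear (fromℕ-central d) ∘ˡ x*-linear b))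
    (resp (sym (trans (solve 2 (λ s p → s :+ (:1 :+ :0) :* (p :* :1) ⊜ s :+ p) refl (S b 1#) p) S-one)) zero∈)
    step
    (λ {d} {u} f g → resp
      (solve 4 (λ n s p u → s :+ n :* (p :* u) :+ p :* u ⊜ s :+ (:1 :+ n) :* (p :* u)) refl (fromℕ d) (S b u) p u)
      (add∈ (up∈ g) (x∈ b f)))
    where
    open Triple b
    -- Common to `q` and `r`: the summand `- p * u * x j` is `- p * (x j * u)` up to a commutator,
    -- which raises the multiple from `d` to `suc d`. The other error is a bracket of `p` with
    -- `x j`.
    mixed∈ : ∀ {d u} j → S b (x j * u) ≈ x j * S b u - p * u * x j →
             F d u → F d (S b u + fromℕ d * (p * u)) →
             F (suc d) (S b (x j * u) + fromℕ (suc d) * (p * (x j * u)))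
    mixed∈ {d} {u} j eq f g = resp (begin
      t * (s + n * (p * u)) - p * (u * t - t * u) + n * ((p * t - t * p) * u)
        ≈⟨ solve 5 (λ n s p t u →
             t :* (s :+ n :* (p :* u)) :- p :* (u :* t :- t :* u) :+ n :* ((p :* t :- t :* p) :* u)
             ⊜ t :* s :- p :* u :* t :+ (:1 :+ n) :* (p :* (t :* u)) :+ (t :* n :- n :* t) :* (p :* u)) refl n s p t u ⟩
      t * s - p * u * t + (1# + n) * (p * (t * u)) + (t * n - n * t) * (p * u)
        ≈⟨ +-cong (+-congʳ (sym eq)) (*-congʳ (+-congʳ (sym (fromℕ-central d t)))) ⟩
      S b (t * u) + (1# + n) * (p * (t * u)) + (n * t - n * t) * (p * u)
        ≈⟨ solve 3 (λ w n v → w :+ (n :- n) :* v ⊜ w) refl _ (n * t) (p * u) ⟩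
      S b (t * u) + (1# + n) * (p * (t * u))  ∎)
      (add∈ (sub∈ (x∈ _ g) (x∈ _ (commutator∈ _ f))) (mul∈ (central-scalar (fromℕ-central d)) (bracket∈ _ _ f)))
      where
      s = S b u
      n = fromℕ d
      t = x j

    step : ∀ {d u} i → F d u → F d (S b u + fromℕ d * (p * u)) →
           F (suc d) (S b (x i * u) + fromℕ (suc d) * (p * (x i * u)))
    step {d} {u} i f g with next-cases b i
    ... | inj₂ (inj₁ ≡.refl) = mixed∈ (next b) (S-step-q u) f g
    ... | inj₂ (inj₂ ≡.refl) = mixed∈ (next (next b)) (S-step-r u) f g
    -- Up to commutators `q * u * q + r * u * r` is `(c - p * p) * u`, so the multiple again grows
    -- by one; `c * u` stays in `F d` because `c` is a scalar.
    ... | inj₁ ≡.refl = resp (begin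
      p * (s + n * (p * u)) + (q * (u * q - q * u) + r * (u * r - r * u) + c * u)
        ≈⟨ +-congˡ (+-congˡ (*-congʳ c-expand)) ⟩
      p * (s + n * (p * u)) + (q * (u * q - q * u) + r * (u * r - r * u) + (p * p + (q * q + r * r)) * u)
        ≈⟨ solve 6 (λ n s p q r u →
             p :* (s :+ n :* (p :* u)) :+ (q :* (u :* q :- q :* u) :+ r :* (u :* r :- r :* u)
                                           :+ (p :* p :+ (q :* q :+ r :* r)) :* u)
             ⊜ p :* s :+ (q :* u :* q :+ r :* u :* r) :+ (p :* (p :* u) :+ p :* n :* (p :* u))) refl n s p q r u ⟩
      p * s + (q * u * q + r * u * r) + (p * (p * u) + p * n * (p * u))
        ≈⟨ +-cong (S-step-p u) (+-congˡ (*-congʳ (fromℕ-central d p))) ⟨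
      S b (p * u) + (p * (p * u) + n * p * (p * u))
        ≈⟨ +-congˡ (solve 3 (λ n p u → p :* (p :* u) :+ n :* p :* (p :* u) ⊜ (:1 :+ n) :* (p :* (p :* u))) refl n p u) ⟩
      S b (p * u) + (1# + n) * (p * (p * u)) ∎)
      (add∈ (x∈ _ g) (add∈ (add∈ (x∈ _ (commutator∈ _ f)) (x∈ _ (commutator∈ _ f))) (up∈ (mul∈ c-scalar f))))
      where
      s = S b u
      n = fromℕ d

  fromℕ-+ : ∀ m n → fromℕ (m ℕ.+ n) ≈ fromℕ m + fromℕ n
  fromℕ-+ zero    n = sym (+-identityˡ _)
  fromℕ-+ (suc m) n = trans (+-congˡ (fromℕ-+ m n)) (sym (+-assoc _ _ _))

  tri-pred : ∀ d → tri d ≡ d ℕ.+ tri (pred d)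
  tri-pred zero    = ≡.refl
  tri-pred (suc d) = ≡.refl

  pred-x∈ : ∀ {d u} i → F (pred d) u → F d (x i * u)
  pred-x∈ {zero}  i f = resp (sym (trans (*-congˡ (F-zero f)) (zeroʳ _))) zero∈
  pred-x∈ {suc d} i f = x∈ i f

  pred-up∈ : ∀ {d u} → F (pred d) u → F d u
  pred-up∈ {zero}  f = f
  pred-up∈ {suc d} f = up∈ f

  -- By `T-step` a new letter adds `S i u` to `x i * T u`, and `S-top` turns this into
  -- `- fromℕ d * (x i * u)`. The constants therefore satisfy the recursion of `tri`.
  T-lowers : ∀ {d u} → F d u → F (pred d) (T u - c * u + fromℕ (tri (pred d)) * u)
  T-lowers = F-map pred (λ d u → T u - c * u + fromℕ (tri (pred d)) * u)
    (λ d → T-linear -ˡ c*-linear +ˡ central*-linear (fromℕ-central (tri (pred d))))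
    -- `T 1#` is exactly `c` and `tri 0` is 0, so the difference vanishes, as membership in `F 0`
    -- demands.
    (resp (solve 3 (λ p q r → :0 ⊜
             p :* :1 :* p :+ (q :* :1 :* q :+ r :* :1 :* r) :- (p :* p :+ (q :* q :+ r :* r)) :* :1 :+ :0 :* :1)
             refl (x zero) (x (suc zero)) (x (suc (suc zero)))) zero∈)
    (λ {d} {u} i f g → resp (begin
      x i * (T u - c * u + m d * u) + (S i u + fromℕ d * (x i * u))
        ≈⟨ solve 7 (λ p t c m s n u → p :* (t :- c :* u :+ m :* u) :+ (s :+ n :* (p :* u))
                                    ⊜ p :* t :+ s :- p :* c :* u :+ (n :* (p :* u) :+ p :* m :* u))
                 refl (x i) (T u) c (m d) (S i u) (fromℕ d) u ⟩
      x i * T u + S i u - x i * c * u + (fromℕ d * (x i * u) + x i * m d * u)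
        ≈⟨ +-cong (+-cong (Triple.T-step i u) (-‿cong (*-congʳ (c-scalar i))))
                  (+-congˡ (*-congʳ (fromℕ-central (tri (pred d)) (x i)))) ⟨
      T (x i * u) - c * x i * u + (fromℕ d * (x i * u) + m d * x i * u)
        ≈⟨ solve 6 (λ p t c m n u → t :- c :* p :* u :+ (n :* (p :* u) :+ m :* p :* u)
                                  ⊜ t :- c :* (p :* u) :+ (n :+ m) :* (p :* u))
                 refl (x i) (T (x i * u)) c (m d) (fromℕ d) u ⟩
      T (x i * u) - c * (x i * u) + (fromℕ d + m d) * (x i * u)
        ≈⟨ +-congˡ (*-congʳ (tri-split d)) ⟨
      T (x i * u) - c * (x i * u) + fromℕ (tri d) * (x i * u)  ∎)
      (add∈ (pred-x∈ i g) (S-top i f)))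
    -- Raising the bound by one changes the constant from `tri (pred d)` to `tri d`; the excess
    -- `fromℕ d * u` is itself in `F d`.
    (λ {d} {u} f g → resp (begin
      T u - c * u + m d * u + fromℕ d * u
        ≈⟨ solve 4 (λ w m n u → w :+ m :* u :+ n :* u ⊜ w :+ (n :+ m) :* u) refl _ (m d) (fromℕ d) u ⟩
      T u - c * u + (fromℕ d + m d) * u  ≈⟨ +-congˡ (*-congʳ (tri-split d)) ⟨
      T u - c * u + fromℕ (tri d) * u    ∎)
      (add∈ (pred-up∈ g) (mul∈ (central-scalar (fromℕ-central d)) f)))
    where
    m : ℕ → Carrier
    m d = fromℕ (tri (pred d))
    tri-split : ∀ d → fromℕ (tri d) ≈ fromℕ d + m d
    tri-split d = trans (reflexive (≡.cong fromℕ (tri-pred d))) (fromℕ-+ d _)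

-- Polynomials acting on an abelian group

-- The innermost application is made first, as in the recursion of `eval`, so that `eval-sum` needs
-- no rearrangement.
iterate : ∀ {a} {M : Set a} → (M → M) → ℕ → M → M
iterate X zero    m = m
iterate X (suc n) m = iterate X n (X m)

module AdditiveMaps {a ℓ} (M : AbelianGroup a ℓ) where
  open AbelianGroup M

  record IsAdditive (Y : Carrier → Carrier) : Set (a ⊔ ℓ) where
    field
      cong   : ∀ {m n} → m ≈ n → Y m ≈ Y n
      ∙-homo : ∀ m n → Y (m ∙ n) ≈ Y m ∙ Y n
      ε-homo : Y ε ≈ ε

  Σ< : ℕ → (ℕ → Carrier) → Carrier
  Σ< zero    f = ε
  Σ< (suc n) f = f 0 ∙ Σ< n (f ∘ suc)

  Σ<-cong : ∀ n {f g} → (∀ i → f i ≈ g i) → Σ< n f ≈ Σ< n g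
  Σ<-cong zero    eq = refl
  Σ<-cong (suc n) eq = ∙-cong (eq 0) (Σ<-cong n (eq ∘ suc))

-- Used twice: for ℤ acting by multiples with X = (c *_), and then for ℤ[c]
-- acting through the first evaluation with X = T.
module Evaluation {a ℓ t} (M : AbelianGroup a ℓ) {T : Set t} (0ₜ : T) (_⊕_ _⊗_ : T → T → T) where
  open AbelianGroup M
  open PolyOps 0ₜ _⊕_ _⊗_
  open AdditiveMaps M
  open import Algebra.Properties.CommutativeSemigroup commutativeSemigroup using (interchange)
  open import Relation.Binary.Reasoning.Setoid setoid

  -- No laws are asked of the coefficients, only compatibility with their raw operations: lists
  -- differing by trailing zeros are distinct elements that act alike.
  record IsAction (act : T → Carrier → Carrier) : Set (a ⊔ ℓ ⊔ t) where
    field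
      additive : ∀ u → IsAdditive (act u)
      ⊕-homo   : ∀ u v m → act (u ⊕ v) m ≈ act u m ∙ act v m
      ⊗-homo   : ∀ u v m → act (u ⊗ v) m ≈ act u (act v m)
      0-homo   : ∀ m → act 0ₜ m ≈ ε

  module Eval {act : T → Carrier → Carrier} {X : Carrier → Carrier}
              (isAction : IsAction act) (X-additive : IsAdditive X)
              (X-act : ∀ u m → X (act u m) ≈ act u (X m)) where
    open IsAction isAction
    open module Act u = IsAdditive (additive u) using () renaming (cong to act-cong; ∙-homo to act-∙; ε-homo to act-ε)

    eval : List T → Carrier → Carrier
    eval []      m = ε
    eval (u ∷ p) m = act u m ∙ eval p (X m)

    eval-additive : ∀ p → IsAdditive (eval p)
    eval-additive [] = record { cong = λ _ → refl ; ∙-homo = λ _ _ → sym (identityˡ ε) ; ε-homo = refl }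
    eval-additive (u ∷ p) = record
      { cong   = λ eq → ∙-cong (act-cong u eq) (p.cong (X.cong eq))
      ; ∙-homo = λ m n → begin
          act u (m ∙ n) ∙ eval p (X (m ∙ n))                    ≈⟨ ∙-cong (act-∙ u m n) (trans (p.cong (X.∙-homo m n)) (p.∙-homo _ _)) ⟩
          act u m ∙ act u n ∙ (eval p (X m) ∙ eval p (X n))     ≈⟨ interchange _ _ _ _ ⟩
          act u m ∙ eval p (X m) ∙ (act u n ∙ eval p (X n))     ∎
      ; ε-homo = trans (∙-cong (act-ε u) (trans (p.cong X.ε-homo) p.ε-homo)) (identityˡ ε)
      }
      where module p = IsAdditive (eval-additive p)
            module X = IsAdditive X-additive

    eval-commute : ∀ {Y} → IsAdditive Y → (∀ u m → Y (act u m) ≈ act u (Y m)) → (∀ m → Y (X m) ≈ X (Y m)) →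
                   ∀ p m → Y (eval p m) ≈ eval p (Y m)
    eval-commute {Y} Y-add Y-act Y-X []      m = IsAdditive.ε-homo Y-add
    eval-commute {Y} Y-add Y-act Y-X (u ∷ p) m = begin
      Y (act u m ∙ eval p (X m))      ≈⟨ IsAdditive.∙-homo Y-add _ _ ⟩
      Y (act u m) ∙ Y (eval p (X m))  ≈⟨ ∙-cong (Y-act u m) (eval-commute Y-add Y-act Y-X p (X m)) ⟩
      act u (Y m) ∙ eval p (Y (X m))  ≈⟨ ∙-congˡ (IsAdditive.cong (eval-additive p) (Y-X m)) ⟩
      act u (Y m) ∙ eval p (X (Y m))  ∎

    eval-addP : ∀ p q m → eval (addP p q) m ≈ eval p m ∙ eval q m
    eval-addP []      q       m = sym (identityˡ _)
    eval-addP (u ∷ p) []      m = sym (identityʳ _)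
    eval-addP (u ∷ p) (v ∷ q) m = trans (∙-cong (⊕-homo u v m) (eval-addP p q (X m))) (interchange _ _ _ _)

    eval-scale : ∀ u q m → eval (map (u ⊗_) q) m ≈ act u (eval q m)
    eval-scale u []      m = sym (act-ε u)
    eval-scale u (v ∷ q) m = trans (∙-cong (⊗-homo u v m) (eval-scale u q (X m))) (sym (act-∙ u _ _))

    -- Products become composites with the right factor acting first; this rests on `X` commuting
    -- with the coefficients.
    eval-mulP : ∀ p q m → eval (mulP p q) m ≈ eval p (eval q m)
    eval-mulP []      q m = refl
    eval-mulP (u ∷ p) q m = begin
      eval (addP (map (u ⊗_) q) (0ₜ ∷ mulP p q)) m
        ≈⟨ eval-addP (map (u ⊗_) q) (0ₜ ∷ mulP p q) m ⟩
      eval (map (u ⊗_) q) m ∙ (act 0ₜ m ∙ eval (mulP p q) (X m))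
        ≈⟨ ∙-cong (eval-scale u q m) (trans (∙-cong (0-homo m) (eval-mulP p q (X m))) (identityˡ _)) ⟩
      act u (eval q m) ∙ eval p (eval q (X m))
        ≈⟨ ∙-congˡ (IsAdditive.cong (eval-additive p) (eval-commute X-additive X-act (λ _ → refl) q m)) ⟨
      act u (eval q m) ∙ eval p (X (eval q m))
        ∎

    eval-sum : ∀ p m → Σ< (length p) (λ i → act (coeff p i) (iterate X i m)) ≈ eval p m
    eval-sum []      m = refl
    eval-sum (u ∷ p) m = ∙-congˡ (eval-sum p (X m))

-- `pPoly n` evaluated at `T` kills short words

module Annihilation {a ℓ} {A : Ring a ℓ} (D : Sl2Datum A) where
  open Ring A hiding (zero)
  open Sl2Datum D
  open WeightSystem D
  open NoncommutativeSolver A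
  open Filtration D
  open AdditiveMaps +-abelianGroup
  open import Algebra.Properties.Ring A using (-‿distribˡ-*; -‿distribʳ-*)
  open import Algebra.Properties.Group +-group using (ε⁻¹≈ε; ⁻¹-involutive)
  open import Relation.Binary.Reasoning.Setoid setoid

  fromℕ-* : ∀ m n → fromℕ (m ℕ.* n) ≈ fromℕ m * fromℕ n
  fromℕ-* zero    n = sym (zeroˡ _)
  fromℕ-* (suc m) n = begin
    fromℕ (n ℕ.+ m ℕ.* n)            ≈⟨ fromℕ-+ n (m ℕ.* n) ⟩
    fromℕ n + fromℕ (m ℕ.* n)        ≈⟨ +-congˡ (fromℕ-* m n) ⟩
    fromℕ n + fromℕ m * fromℕ n      ≈⟨ solve 2 (λ m n → n :+ m :* n ⊜ (:1 :+ m) :* n) refl (fromℕ m) (fromℕ n) ⟩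
    (1# + fromℕ m) * fromℕ n         ∎

  fromℤ-⊖ : ∀ m n → fromℤ (m ℤ.⊖ n) ≈ fromℕ m - fromℕ n
  fromℤ-⊖ zero    zero    = sym (-‿inverseʳ 0#)
  fromℤ-⊖ zero    (suc n) = sym (+-identityˡ _)
  fromℤ-⊖ (suc m) zero    = solve 1 (λ m → m ⊜ m :- :0) refl (fromℕ (suc m))
  fromℤ-⊖ (suc m) (suc n) = begin
    fromℤ (suc m ℤ.⊖ suc n)          ≡⟨ ≡.cong fromℤ (ℤₚ.[1+m]⊖[1+n]≡m⊖n m n) ⟩
    fromℤ (m ℤ.⊖ n)                  ≈⟨ fromℤ-⊖ m n ⟩
    fromℕ m - fromℕ n                ≈⟨ solve 2 (λ m n → m :- n ⊜ (:1 :+ m) :- (:1 :+ n)) refl (fromℕ m) (fromℕ n) ⟩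
    fromℕ (suc m) - fromℕ (suc n)    ∎

  fromℤ-+ : ∀ i j → fromℤ (i ℤ.+ j) ≈ fromℤ i + fromℤ j
  fromℤ-+ (+ m)    (+ n)    = fromℕ-+ m n
  fromℤ-+ (+ m)    -[1+ n ] = fromℤ-⊖ m (suc n)
  fromℤ-+ -[1+ m ] (+ n)    = trans (fromℤ-⊖ n (suc m)) (+-comm _ _)
  fromℤ-+ -[1+ m ] -[1+ n ] = begin
    - (1# + (1# + fromℕ (m ℕ.+ n)))          ≈⟨ -‿cong (+-congˡ (+-congˡ (fromℕ-+ m n))) ⟩
    - (1# + (1# + (fromℕ m + fromℕ n)))
      ≈⟨ solve 2 (λ m n → :- (:1 :+ (:1 :+ (m :+ n))) ⊜ :- (:1 :+ m) :+ :- (:1 :+ n)) refl (fromℕ m) (fromℕ n) ⟩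
    - (1# + fromℕ m) + - (1# + fromℕ n)      ∎

  fromℤ-neg : ∀ i → fromℤ (ℤ.- i) ≈ - fromℤ i
  fromℤ-neg (+ zero)  = sym ε⁻¹≈ε
  fromℤ-neg (+ suc n) = refl
  fromℤ-neg -[1+ n ]  = sym (⁻¹-involutive _)

  fromℤ-*-pos : ∀ m n → fromℤ (+ m ℤ.* + n) ≈ fromℕ m * fromℕ n
  fromℤ-*-pos m n = trans (reflexive (≡.cong fromℤ (≡.sym (ℤₚ.pos-* m n)))) (fromℕ-* m n)

  fromℤ-*-posˡ : ∀ m j → fromℤ (+ m ℤ.* j) ≈ fromℕ m * fromℤ j
  fromℤ-*-posˡ m (+ n)    = fromℤ-*-pos m n
  fromℤ-*-posˡ m -[1+ n ] = begin
    fromℤ (+ m ℤ.* -[1+ n ])         ≡⟨ ≡.cong fromℤ (ℤₚ.neg-distribʳ-* (+ m) (+ suc n)) ⟨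
    fromℤ (ℤ.- (+ m ℤ.* + suc n))    ≈⟨ fromℤ-neg (+ m ℤ.* + suc n) ⟩
    - fromℤ (+ m ℤ.* + suc n)        ≈⟨ -‿cong (fromℤ-*-pos m (suc n)) ⟩
    - (fromℕ m * fromℕ (suc n))      ≈⟨ -‿distribʳ-* _ _ ⟩
    fromℕ m * - fromℕ (suc n)        ∎

  fromℤ-* : ∀ i j → fromℤ (i ℤ.* j) ≈ fromℤ i * fromℤ j
  fromℤ-* (+ m)    j = fromℤ-*-posˡ m j
  fromℤ-* -[1+ m ] j = begin
    fromℤ (-[1+ m ] ℤ.* j)           ≡⟨ ≡.cong fromℤ (ℤₚ.neg-distribˡ-* (+ suc m) j) ⟨
    fromℤ (ℤ.- (+ suc m ℤ.* j))      ≈⟨ fromℤ-neg (+ suc m ℤ.* j) ⟩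
    - fromℤ (+ suc m ℤ.* j)          ≈⟨ -‿cong (fromℤ-*-posˡ (suc m) j) ⟩
    - (fromℕ (suc m) * fromℤ j)      ≈⟨ -‿distribˡ-* _ _ ⟩
    - fromℕ (suc m) * fromℤ j        ∎

  fromℤ-central : ∀ i → Central (fromℤ i)
  fromℤ-central (+ n)    u = fromℕ-central n u
  fromℤ-central -[1+ n ] u = begin
    - fromℕ (suc n) * u    ≈⟨ -‿distribˡ-* _ _ ⟨
    - (fromℕ (suc n) * u)  ≈⟨ -‿cong (fromℕ-central (suc n) u) ⟩
    - (u * fromℕ (suc n))  ≈⟨ -‿distribʳ-* _ _ ⟩
    u * - fromℕ (suc n)    ∎

  module E₁ = Evaluation +-abelianGroup (+ 0) ℤ._+_ ℤ._*_
  module E₂ = Evaluation +-abelianGroup [] ZC.addP ZC.mulP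

  linear-additive : ∀ {G} → Linear G → IsAdditive G
  linear-additive g = record { cong = Linear.cong g ; ∙-homo = Linear.+-homo g ; ε-homo = Linear.0-homo g }

  fromℤ-action : E₁.IsAction (λ n u → fromℤ n * u)
  fromℤ-action = record
    { additive = λ n → linear-additive (central*-linear (fromℤ-central n))
    ; ⊕-homo   = λ m n u → trans (*-congʳ (fromℤ-+ m n)) (distribʳ u _ _)
    ; ⊗-homo   = λ m n u → trans (*-congʳ (fromℤ-* m n)) (*-assoc _ _ _)
    ; 0-homo   = zeroˡ
    }

  open E₁.Eval fromℤ-action (linear-additive c*-linear)
    (λ n u → Linear.*-homo c*-linear (central-scalar (fromℤ-central n)) u) public
    using () renaming (eval to evalC; eval-additive to evalC-additive; eval-addP to evalC-addP;
                       eval-mulP to evalC-mulP; eval-sum to evalC-sum; eval-commute to evalC-commute)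

  evalC-action : E₂.IsAction evalC
  evalC-action = record
    { additive = evalC-additive
    ; ⊕-homo   = evalC-addP
    ; ⊗-homo   = evalC-mulP
    ; 0-homo   = λ _ → refl
    }

  open E₂.Eval evalC-action (linear-additive T-linear)
    -- `T` commutes with polynomials in `c` because integers and `c` are scalars.
    (evalC-commute (linear-additive T-linear)
      (λ n u → Linear.*-homo T-linear (central-scalar (fromℤ-central n)) u)
      (λ u → Linear.*-homo T-linear c-scalar u)) public
    using (eval-sum; eval-mulP; eval; eval-additive)

  factor-eval : ∀ m u → eval (factor m) u ≈ T u - c * u + fromℕ (tri m) * u
  factor-eval m u = solve 4 (λ t c m u →
      (m :* u :+ ((:- (:1 :+ :0)) :* (c :* u) :+ :0)) :+ (((:1 :+ :0) :* t :+ :0) :+ :0)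
      ⊜ t :- c :* u :+ m :* u) refl (T u) c (fromℕ (tri m)) u

  pPoly-annihilates : ∀ n {u} → F n u → eval (pPoly n) u ≈ 0#
  pPoly-annihilates zero    {u} f =
    trans (IsAdditive.cong (eval-additive (pPoly 0)) (F-zero f)) (IsAdditive.ε-homo (eval-additive (pPoly 0)))
  pPoly-annihilates (suc n) {u} f =
    -- The factor of largest index acts first: `factor n` removes the words of length `n`, the
    -- longest in `F (suc n)`.
    trans (eval-mulP (pPoly n) (factor n) u)
          (pPoly-annihilates n (resp (sym (factor-eval n u)) (T-lowers f)))

-- Duplicate-free lists and chord labels

Unique-resp-↭ : ∀ {a} {B : Set a} {us vs : List B} → us ↭ vs → Unique us → Unique vs
Unique-resp-↭ Perm.refl         uniq                         = uniq
Unique-resp-↭ (Perm.prep u p)   (u∉ ∷ uniq)                  = Permₚ.All-resp-↭ p u∉ ∷ Unique-resp-↭ p uniq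
Unique-resp-↭ (Perm.swap u v p) ((u≢v ∷ u∉) ∷ v∉ ∷ uniq)     =
  ((u≢v ∘ ≡.sym) ∷ Permₚ.All-resp-↭ p v∉) ∷ Permₚ.All-resp-↭ p u∉ ∷ Unique-resp-↭ p uniq
Unique-resp-↭ (Perm.trans p q)  uniq                         = Unique-resp-↭ q (Unique-resp-↭ p uniq)

-- Serves to replace the order in which `deduplicate` lists the labels by one in which chords of the
-- same kind are consecutive.
unique-↭ : ∀ {a} {B : Set a} {us vs : List B} → Unique us → Unique vs →
           (∀ {z} → z ∈ us → z ∈ vs) → (∀ {z} → z ∈ vs → z ∈ us) → us ↭ vs
unique-↭ {us = []}     {[]}     _ _ _ _ = ↭-refl
unique-↭ {us = []}     {v ∷ vs} _ _ _ g with () ← g (here ≡.refl)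
unique-↭ {us = u ∷ us} {vs} (u∉ ∷ uniq) uniq′ f g with ∈-∃++ (f (here ≡.refl))
... | ws , ws′ , ≡.refl = ↭-trans (Perm.prep u (unique-↭ uniq uniq-tail f′ g′)) (↭-sym (Permₚ.shift u ws ws′))
  where
  shifted : Unique (u ∷ ws ++ ws′)
  shifted = Unique-resp-↭ (Permₚ.shift u ws ws′) uniq′
  uniq-tail : Unique (ws ++ ws′)
  uniq-tail with _ ∷ t ← shifted = t
  f′ : ∀ {z} → z ∈ us → z ∈ ws ++ ws′
  f′ z∈ with Permₚ.∈-resp-↭ (Permₚ.shift u ws ws′) (f (there z∈))
  ... | here ≡.refl = ⊥-elim (All.lookup u∉ z∈ ≡.refl)
  ... | there z∈′   = z∈′
  g′ : ∀ {z} → z ∈ ws ++ ws′ → z ∈ us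
  g′ z∈ with g (Permₚ.∈-resp-↭ (↭-sym (Permₚ.shift u ws ws′)) (there z∈))
  ... | here ≡.refl with u∉′ ∷ _ ← shifted = ⊥-elim (All.lookup u∉′ z∈ ≡.refl)
  ... | there z∈′   = z∈′

double : List ℕ → List ℕ
double []       = []
double (l ∷ ls) = l ∷ l ∷ double ls

∈-double⁺ : ∀ {z} ls → z ∈ ls → z ∈ double ls
∈-double⁺ (l ∷ ls) (here eq)  = here eq
∈-double⁺ (l ∷ ls) (there z∈) = there (there (∈-double⁺ ls z∈))

∈-double⁻ : ∀ {z} ls → z ∈ double ls → z ∈ ls
∈-double⁻ (l ∷ ls) (here eq)          = here eq
∈-double⁻ (l ∷ ls) (there (here eq))  = here eq
∈-double⁻ (l ∷ ls) (there (there z∈)) = there (∈-double⁻ ls z∈)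

map-concatMap-double : ∀ (f g : ℕ → ℕ) ts →
  map f (concatMap (λ t → g t ∷ g t ∷ []) ts) ≡ double (map f (map g ts))
map-concatMap-double f g []       = ≡.refl
map-concatMap-double f g (t ∷ ts) = ≡.cong (λ ls → f (g t) ∷ f (g t) ∷ ls) (map-concatMap-double f g ts)

evenL-injective : ∀ {m n} → evenL m ≡ evenL n → m ≡ n
evenL-injective {m} {n} = ℕₚ.*-cancelˡ-≡ m n 2

oddL-injective : ∀ {m n} → oddL m ≡ oddL n → m ≡ n
oddL-injective = evenL-injective ∘ ℕₚ.suc-injective

even-odd-disjoint : ∀ us vs → Disjoint (map evenL us) (map oddL vs)
even-odd-disjoint us vs (z∈ , z∈′) with ∈-map⁻ evenL z∈ | ∈-map⁻ oddL z∈′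
... | m , _ , eq | n , _ , eq′ = ℕₚ.even≢odd m n (≡.trans (≡.sym eq) eq′)

arches : ℕ → ℕ → List ℕ
arches j k = map (k ℕ.+_) (upTo j)

bridges-arches-disjoint : ∀ (f : ℕ → ℕ) → (∀ {m n} → f m ≡ f n → m ≡ n) → ∀ j k →
                          Disjoint (map f (upTo k)) (map f (arches j k))
bridges-arches-disjoint f f-inj j k (z∈ , z∈′) with ∈-map⁻ f z∈ | ∈-map⁻ f z∈′
... | m , m∈ , eq | n , n∈ , eq′ with ∈-map⁻ (k ℕ.+_) n∈
...   | t , _ , eq″ = ℕₚ.<⇒≱ (∈-upTo⁻ m∈)
  (≡.subst (k ℕ.≤_) (≡.trans (≡.sym eq″) (f-inj (≡.trans (≡.sym eq′) eq))) (ℕₚ.m≤m+n k t))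

-- Sums over assignments and the pairing of monomials

module Assignments {a ℓ} {A : Ring a ℓ} (D : Sl2Datum A) where
  open Ring A hiding (zero)
  open Sl2Datum D
  open WeightSystem D
  open NoncommutativeSolver A
  open Filtration D
  open import Relation.Binary.Reasoning.Setoid setoid

  Assignment : Set
  Assignment = ℕ → Fin 3

  Σ₃-cong : ∀ {f g} → (∀ i → f i ≈ g i) → Σ₃ f ≈ Σ₃ g
  Σ₃-cong eq = +-cong (eq _) (+-cong (eq _) (eq _))

  Σ₃-swap : ∀ (f : Fin 3 → Fin 3 → Carrier) → Σ₃ (λ i → Σ₃ (f i)) ≈ Σ₃ (λ j → Σ₃ (λ i → f i j))
  Σ₃-swap f = solve 9 (λ a b c d e f g h i →
      (a :+ (b :+ c)) :+ ((d :+ (e :+ f)) :+ (g :+ (h :+ i)))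
      ⊜ (a :+ (d :+ g)) :+ ((b :+ (e :+ h)) :+ (c :+ (f :+ i)))) refl _ _ _ _ _ _ _ _ _

  Σ₃-*ˡ : ∀ u f → Σ₃ (λ i → u * f i) ≈ u * Σ₃ f
  Σ₃-*ˡ u f = sym (trans (distribˡ u _ _) (+-congˡ (distribˡ u _ _)))

  Σ₃-*ʳ : ∀ u f → Σ₃ (λ i → f i * u) ≈ Σ₃ f * u
  Σ₃-*ʳ u f = sym (trans (distribʳ u _ _) (+-congˡ (distribʳ u _ _)))

  Σ₃-+ : ∀ f g → Σ₃ (λ i → f i + g i) ≈ Σ₃ f + Σ₃ g
  Σ₃-+ f g = solve 6 (λ a b c d e f → (a :+ d) :+ ((b :+ e) :+ (c :+ f)) ⊜ (a :+ (b :+ c)) :+ (d :+ (e :+ f)))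
                   refl _ _ _ _ _ _

  Σ₃-0 : Σ₃ (λ _ → 0#) ≈ 0#
  Σ₃-0 = solve 0 (:0 :+ (:0 :+ :0) ⊜ :0) refl

  update-same : ∀ φ l i → update φ l i l ≡ i
  update-same φ l i with l ℕ.≟ l
  ... | yes _  = ≡.refl
  ... | no l≢l = ⊥-elim (l≢l ≡.refl)

  update-other : ∀ φ l i {m} → l ≢ m → update φ l i m ≡ φ m
  update-other φ l i {m} l≢m with l ℕ.≟ m
  ... | yes l≡m = ⊥-elim (l≢m l≡m)
  ... | no _    = ≡.refl

  update-cong : ∀ {φ ψ} l i → (∀ m → φ m ≡ ψ m) → ∀ m → update φ l i m ≡ update ψ l i m
  update-cong l i eq m with l ℕ.≟ m
  ... | yes _ = ≡.refl
  ... | no _  = eq m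

  update-comm : ∀ φ {l l′} i j → l ≢ l′ → ∀ m → update (update φ l i) l′ j m ≡ update (update φ l′ j) l i m
  update-comm φ {l} {l′} i j l≢l′ m with l′ ℕ.≟ m | l ℕ.≟ m
  ... | yes ≡.refl | yes ≡.refl = ⊥-elim (l≢l′ ≡.refl)
  ... | yes ≡.refl | no l≢m     = ≡.sym (update-same φ l′ j)
  ... | no l′≢m    | yes ≡.refl = update-same φ l i
  ... | no l′≢m    | no l≢m     = ≡.trans (update-other φ l i l≢m) (≡.sym (update-other φ l′ j l′≢m))

  prodW-cong : ∀ {φ ψ} w → (∀ {m} → m ∈ w → φ m ≡ ψ m) → prodW φ w ≡ prodW ψ w
  prodW-cong []      eq = ≡.refl
  prodW-cong (l ∷ w) eq = ≡.cong₂ (λ i r → x i * r) (eq (here ≡.refl)) (prodW-cong w (eq ∘ there))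

  prodW-++ : ∀ φ u v → prodW φ (u ++ v) ≈ prodW φ u * prodW φ v
  prodW-++ φ []      v = sym (*-identityˡ _)
  prodW-++ φ (l ∷ u) v = trans (*-congˡ (prodW-++ φ u v)) (sym (*-assoc _ _ _))

  sumAssign-cong : ∀ ls {φ ψ} w → (∀ m → φ m ≡ ψ m) → sumAssign ls φ w ≈ sumAssign ls ψ w
  sumAssign-cong []       w eq = reflexive (prodW-cong w (λ {m} _ → eq m))
  sumAssign-cong (l ∷ ls) w eq = Σ₃-cong (λ i → sumAssign-cong ls w (update-cong l i eq))

  sumAssign-↭ : ∀ {ls ls′} → ls ↭ ls′ → ∀ φ w → sumAssign ls φ w ≈ sumAssign ls′ φ w
  sumAssign-↭ Perm.refl          φ w = refl
  sumAssign-↭ (Perm.prep l p)    φ w = Σ₃-cong (λ i → sumAssign-↭ p (update φ l i) w)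
  sumAssign-↭ (Perm.trans p q)   φ w = trans (sumAssign-↭ p φ w) (sumAssign-↭ q φ w)
  sumAssign-↭ (Perm.swap {ys = ls′} l l′ p) φ w with l ℕ.≟ l′
  -- Equal labels give the same double sum on both sides; the two updates would not commute, since
  -- the later one wins.
  ... | yes ≡.refl = Σ₃-cong (λ i → Σ₃-cong (λ j → sumAssign-↭ p (update (update φ l i) l j) w))
  ... | no l≢l′    = trans
    (Σ₃-cong (λ i → Σ₃-cong (λ j → trans (sumAssign-↭ p (update (update φ l i) l′ j) w)
                                         (sumAssign-cong ls′ w (update-comm φ i j l≢l′)))))
    (Σ₃-swap (λ i j → sumAssign ls′ (update (update φ l′ j) l i) w))

  -- `sumAssign` with the summand as a function of the assignment, so that factors free of the
  -- summed labels can be pulled out.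
  sumOver : List ℕ → Assignment → (Assignment → Carrier) → Carrier
  sumOver []       φ V = V φ
  sumOver (l ∷ ls) φ V = Σ₃ (λ i → sumOver ls (update φ l i) V)

  sumAssign-sumOver : ∀ ls φ w → sumAssign ls φ w ≈ sumOver ls φ (λ ψ → prodW ψ w)
  sumAssign-sumOver []       φ w = refl
  sumAssign-sumOver (l ∷ ls) φ w = Σ₃-cong (λ i → sumAssign-sumOver ls (update φ l i) w)

  sumOver-++ : ∀ ls ls′ φ V → sumOver (ls ++ ls′) φ V ≈ sumOver ls φ (λ ψ → sumOver ls′ ψ V)
  sumOver-++ []       ls′ φ V = refl
  sumOver-++ (l ∷ ls) ls′ φ V = Σ₃-cong (λ i → sumOver-++ ls ls′ (update φ l i) V)

  AgreeOff : List ℕ → Assignment → Assignment → Set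
  AgreeOff ls φ ψ = ∀ {m} → m ∉ ls → ψ m ≡ φ m

  -- Only assignments agreeing with `φ` outside `ls` occur in the sum; this lets factors that avoid
  -- `ls` be treated as constants.
  sumOver-cong : ∀ ls φ {V V′} → (∀ ψ → AgreeOff ls φ ψ → V ψ ≈ V′ ψ) → sumOver ls φ V ≈ sumOver ls φ V′
  sumOver-cong []       φ eq = eq φ (λ _ → ≡.refl)
  sumOver-cong (l ∷ ls) φ eq = Σ₃-cong (λ i → sumOver-cong ls (update φ l i) (λ ψ off → eq ψ (λ m∉ →
    ≡.trans (off (m∉ ∘ there)) (update-other φ l i (λ l≡m → m∉ (here (≡.sym l≡m)))))))

  sumOver-*ˡ : ∀ ls φ u V → sumOver ls φ (λ ψ → u * V ψ) ≈ u * sumOver ls φ V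
  sumOver-*ˡ []       φ u V = refl
  sumOver-*ˡ (l ∷ ls) φ u V = trans (Σ₃-cong (λ i → sumOver-*ˡ ls (update φ l i) u V)) (Σ₃-*ˡ u (λ i → sumOver ls (update φ l i) V))

  sumOver-*ʳ : ∀ ls φ u V → sumOver ls φ (λ ψ → V ψ * u) ≈ sumOver ls φ V * u
  sumOver-*ʳ []       φ u V = refl
  sumOver-*ʳ (l ∷ ls) φ u V = trans (Σ₃-cong (λ i → sumOver-*ʳ ls (update φ l i) u V)) (Σ₃-*ʳ u (λ i → sumOver ls (update φ l i) V))

  prodW-off : ∀ {ls φ ψ} → AgreeOff ls φ ψ → ∀ w → Disjoint w ls → prodW ψ w ≡ prodW φ w
  prodW-off off w disj = prodW-cong w (λ m∈w → off (λ m∈ls → disj (m∈w , m∈ls)))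

  c^ : ℕ → Carrier
  c^ zero    = 1#
  c^ (suc j) = c * c^ j

  -- An isolated arch is an adjacent pair, and the sum over its three values is `c`. Uniqueness
  -- keeps later updates from overwriting the value at `l`.
  sumOver-arches : ∀ ls φ → Unique ls → sumOver ls φ (λ ψ → prodW ψ (double ls)) ≈ c^ (length ls)
  sumOver-arches []       φ _            = refl
  sumOver-arches (l ∷ ls) φ (l∉ ∷ uniq) = begin
    Σ₃ (λ i → sumOver ls (update φ l i) (λ ψ → x (ψ l) * (x (ψ l) * prodW ψ (double ls))))
      ≈⟨ Σ₃-cong (λ i → sumOver-cong ls (update φ l i) (λ ψ off → reflexive
           (≡.cong (λ m → x m * (x m * prodW ψ (double ls)))
                   (≡.trans (off (λ l∈ → All.lookup l∉ l∈ ≡.refl)) (update-same φ l i))))) ⟩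
    Σ₃ (λ i → sumOver ls (update φ l i) (λ ψ → x i * (x i * prodW ψ (double ls))))
      ≈⟨ Σ₃-cong (λ i → trans (sumOver-*ˡ ls _ (x i) _) (*-congˡ (trans (sumOver-*ˡ ls _ (x i) _)
           (*-congˡ (sumOver-arches ls (update φ l i) uniq))))) ⟩
    Σ₃ (λ i → x i * (x i * c^ (length ls)))
      ≈⟨ Σ₃-cong (λ i → *-assoc (x i) (x i) (c^ (length ls))) ⟨
    Σ₃ (λ i → x i * x i * c^ (length ls))
      ≈⟨ Σ₃-*ʳ (c^ (length ls)) (λ i → x i * x i) ⟩
    c * c^ (length ls)  ∎

  sumWords : ℕ → (List (Fin 3) → Carrier) → Carrier
  sumWords zero    f = f []
  sumWords (suc n) f = Σ₃ (λ i → sumWords n (λ b → f (i ∷ b)))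

  -- For distinct labels an assignment on `ls` is just a word in three letters; from here on the
  -- labels disappear.
  sumOver-words : ∀ ls φ f → Unique ls → sumOver ls φ (λ ψ → f (map ψ ls)) ≈ sumWords (length ls) f
  sumOver-words []       φ f _           = refl
  sumOver-words (l ∷ ls) φ f (l∉ ∷ uniq) = Σ₃-cong (λ i → trans
    (sumOver-cong ls (update φ l i) (λ ψ off → reflexive
      (≡.cong (λ m → f (m ∷ map ψ ls)) (≡.trans (off (λ l∈ → All.lookup l∉ l∈ ≡.refl)) (update-same φ l i)))))
    (sumOver-words ls (update φ l i) (λ b → f (i ∷ b)) uniq))

  sumWords-cong : ∀ n {f g} → (∀ b → length b ≡ n → f b ≈ g b) → sumWords n f ≈ sumWords n g
  sumWords-cong zero    eq = eq [] ≡.refl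
  sumWords-cong (suc n) eq = Σ₃-cong (λ i → sumWords-cong n (λ b len → eq (i ∷ b) (≡.cong suc len)))

  sumWords-*ˡ : ∀ n u f → sumWords n (λ b → u * f b) ≈ u * sumWords n f
  sumWords-*ˡ zero    u f = refl
  sumWords-*ˡ (suc n) u f = trans (Σ₃-cong (λ i → sumWords-*ˡ n u (λ b → f (i ∷ b)))) (Σ₃-*ˡ u (λ i → sumWords n (λ b → f (i ∷ b))))

  sumWords-*ʳ : ∀ n u f → sumWords n (λ b → f b * u) ≈ sumWords n f * u
  sumWords-*ʳ zero    u f = refl
  sumWords-*ʳ (suc n) u f = trans (Σ₃-cong (λ i → sumWords-*ʳ n u (λ b → f (i ∷ b)))) (Σ₃-*ʳ u (λ i → sumWords n (λ b → f (i ∷ b))))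

  sumWords-+ : ∀ n f g → sumWords n (λ b → f b + g b) ≈ sumWords n f + sumWords n g
  sumWords-+ zero    f g = refl
  sumWords-+ (suc n) f g = trans (Σ₃-cong (λ i → sumWords-+ n (λ b → f (i ∷ b)) (λ b → g (i ∷ b))))
    (Σ₃-+ (λ i → sumWords n (λ b → f (i ∷ b))) (λ i → sumWords n (λ b → g (i ∷ b))))

  sumWords-0 : ∀ n → sumWords n (λ _ → 0#) ≈ 0#
  sumWords-0 zero    = refl
  sumWords-0 (suc n) = trans (Σ₃-cong (λ _ → sumWords-0 n)) Σ₃-0

  sumWords-Σ₃ : ∀ n (f : Fin 3 → List (Fin 3) → Carrier) →
                sumWords n (λ b → Σ₃ (λ i → f i b)) ≈ Σ₃ (λ i → sumWords n (f i))
  sumWords-Σ₃ n f = trans (sumWords-+ n _ _) (+-congˡ (sumWords-+ n _ _))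

  sumWords-swap : ∀ m n (f : List (Fin 3) → List (Fin 3) → Carrier) →
                  sumWords m (λ a → sumWords n (f a)) ≈ sumWords n (λ b → sumWords m (λ a → f a b))
  sumWords-swap zero    n f = refl
  sumWords-swap (suc m) n f = trans (Σ₃-cong (λ i → sumWords-swap m n (λ a → f (i ∷ a)))) 
    (sym (sumWords-Σ₃ n (λ i b → sumWords m (λ a → f (i ∷ a) b))))

  word : List (Fin 3) → Carrier
  word b = foldr (λ i r → x i * r) 1# b

  prodW-word : ∀ ψ w → prodW ψ w ≡ word (map ψ w)
  prodW-word ψ []      = ≡.refl
  prodW-word ψ (l ∷ w) = ≡.cong (x (ψ l) *_) (prodW-word ψ w)

  word-∷ʳ : ∀ b i → word (b ∷ʳ i) ≈ word b * x i
  word-∷ʳ []      i = trans (*-identityʳ _) (sym (*-identityˡ _))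
  word-∷ʳ (j ∷ b) i = trans (*-congˡ (word-∷ʳ b i)) (sym (*-assoc _ _ _))

  word-reverse-∷ : ∀ i b → word (reverse (i ∷ b)) ≈ word (reverse b) * x i
  word-reverse-∷ i b = trans (reflexive (≡.cong word (Listₚ.unfold-reverse i b))) (word-∷ʳ (reverse b) i)

  scalar-word : ∀ {s} → Scalar s → ∀ b → s * word b ≈ word b * s
  scalar-word sc []      = trans (*-identityʳ _) (sym (*-identityˡ _))
  scalar-word sc (i ∷ b) = trans (sym (x-scalar-swap sc i (word b)))
                                 (trans (*-congˡ (scalar-word sc b)) (sym (*-assoc _ _ _)))

  c^-scalar : ∀ j → Scalar (c^ j)
  c^-scalar zero    i = trans (*-identityˡ _) (sym (*-identityʳ _))
  c^-scalar (suc j) i = begin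
    c * c^ j * x i    ≈⟨ *-assoc _ _ _ ⟩
    c * (c^ j * x i)  ≈⟨ *-congˡ (c^-scalar j i) ⟩
    c * (x i * c^ j)  ≈⟨ *-assoc _ _ _ ⟨
    c * x i * c^ j    ≈⟨ *-congʳ (c-scalar i) ⟩
    x i * c * c^ j    ≈⟨ *-assoc _ _ _ ⟩
    x i * (c * c^ j)  ∎

  T-iterate : ∀ k u → T (iterate T k u) ≈ iterate T k (T u)
  T-iterate zero    u = refl
  T-iterate (suc k) u = T-iterate k (T u)

  -- Nested bridges around `u`: the first letter of `a` is the outermost layer, and summing over it
  -- is one application of `T`.
  sumWords-sandwich : ∀ k u → sumWords k (λ a → word a * u * word (reverse a)) ≈ iterate T k u
  sumWords-sandwich zero    u = trans (*-identityʳ _) (*-identityˡ u)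
  sumWords-sandwich (suc k) u = begin
    Σ₃ (λ i → sumWords k (λ a → x i * word a * u * word (reverse (i ∷ a))))
      ≈⟨ Σ₃-cong (λ i → sumWords-cong k (λ a _ → trans (*-congˡ (word-reverse-∷ i a))
           (solve 4 (λ p w u v → p :* w :* u :* (v :* p) ⊜ p :* (w :* u :* v) :* p) refl (x i) (word a) u (word (reverse a))))) ⟩
    Σ₃ (λ i → sumWords k (λ a → x i * (word a * u * word (reverse a)) * x i))
      ≈⟨ Σ₃-cong (λ i → trans (sumWords-*ʳ k (x i) _) (*-congʳ (trans (sumWords-*ˡ k (x i) _) (*-congˡ (sumWords-sandwich k u))))) ⟩
    T (iterate T k u)
      ≈⟨ T-iterate k u ⟩
    iterate T k (T u)  ∎

  module MonomialPairing (j k j′ k′ : ℕ) where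
    es bs αs βs : List ℕ
    es = map evenL (upTo k)
    bs = map oddL (upTo k′)
    αs = map evenL (arches j k)
    βs = map oddL (arches j′ k′)

    -- `closed` displays the blocks of the closure; the second reading of each family of bridges is
    -- reversed. In `labels` the arches come last, so their sums are innermost and collapse to
    -- powers of `c` before the bridges are treated.
    labels closed : List ℕ
    labels = es ++ (bs ++ (αs ++ βs))
    closed = ((es ++ double αs) ++ (bs ++ double βs)) ++ (reverse es ++ reverse bs)

    strand₁-eq : ∀ f j k → map f (strand₁ (monoShare j k)) ≡ map f (upTo k) ++ double (map f (arches j k))
    strand₁-eq f j k = ≡.trans (Listₚ.map-++ f (upTo k) _)
                               (≡.cong (map f (upTo k) ++_) (map-concatMap-double f (k ℕ.+_) (upTo j)))

    closure-eq : closure (monoShare j k · monoShare j′ k′) ≡ closed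
    closure-eq = ≡.cong₂ _++_
      (≡.cong₂ _++_ (strand₁-eq evenL j k) (strand₁-eq oddL j′ k′))
      (≡.cong₂ _++_ (Listₚ.reverse-map evenL (upTo k)) (Listₚ.reverse-map oddL (upTo k′)))

    es-bs : Disjoint es bs
    es-bs = even-odd-disjoint (upTo k) (upTo k′)
    es-αs : Disjoint es αs
    es-αs = bridges-arches-disjoint evenL evenL-injective j k
    es-βs : Disjoint es βs
    es-βs = even-odd-disjoint (upTo k) (arches j′ k′)
    bs-αs : Disjoint bs αs
    bs-αs (z∈ , z∈′) = even-odd-disjoint (arches j k) (upTo k′) (z∈′ , z∈)
    bs-βs : Disjoint bs βs
    bs-βs = bridges-arches-disjoint oddL oddL-injective j′ k′
    αs-βs : Disjoint αs βs
    αs-βs = even-odd-disjoint (arches j k) (arches j′ k′)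

    es-unique : Unique es
    es-unique = Uniqueₚ.map⁺ evenL-injective (Uniqueₚ.upTo⁺ k)
    bs-unique : Unique bs
    bs-unique = Uniqueₚ.map⁺ oddL-injective (Uniqueₚ.upTo⁺ k′)
    αs-unique : Unique αs
    αs-unique = Uniqueₚ.map⁺ evenL-injective (Uniqueₚ.map⁺ (ℕₚ.+-cancelˡ-≡ k _ _) (Uniqueₚ.upTo⁺ j))
    βs-unique : Unique βs
    βs-unique = Uniqueₚ.map⁺ oddL-injective (Uniqueₚ.map⁺ (ℕₚ.+-cancelˡ-≡ k′ _ _) (Uniqueₚ.upTo⁺ j′))

    disjoint-++ : ∀ {us vs ws : List ℕ} → Disjoint us vs → Disjoint us ws → Disjoint us (vs ++ ws)
    disjoint-++ {vs = vs} d d′ (z∈ , z∈′) = [ (λ z∈vs → d (z∈ , z∈vs)) , (λ z∈ws → d′ (z∈ , z∈ws)) ]′ (∈-++⁻ vs z∈′)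

    labels-unique : Unique labels
    labels-unique = Uniqueₚ.++⁺ es-unique
      (Uniqueₚ.++⁺ bs-unique (Uniqueₚ.++⁺ αs-unique βs-unique αs-βs) (disjoint-++ bs-αs bs-βs))
      (disjoint-++ es-bs (disjoint-++ es-αs es-βs))

    closed⊆labels : ∀ {z} → z ∈ closed → z ∈ labels
    closed⊆labels z∈ with ∈-++⁻ ((es ++ double αs) ++ (bs ++ double βs)) z∈
    ... | inj₂ z∈₂ = [ ∈-++⁺ˡ ∘ Anyₚ.reverse⁻ {xs = es} , ∈-++⁺ʳ es ∘ ∈-++⁺ˡ ∘ Anyₚ.reverse⁻ {xs = bs} ]′ (∈-++⁻ (reverse es) z∈₂)
    ... | inj₁ z∈₁ with ∈-++⁻ (es ++ double αs) z∈₁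
    ...   | inj₁ z∈I = [ ∈-++⁺ˡ , ∈-++⁺ʳ es ∘ ∈-++⁺ʳ bs ∘ ∈-++⁺ˡ ∘ ∈-double⁻ αs ]′ (∈-++⁻ es z∈I)
    ...   | inj₂ z∈H = ∈-++⁺ʳ es ([ ∈-++⁺ˡ , ∈-++⁺ʳ bs ∘ ∈-++⁺ʳ αs ∘ ∈-double⁻ βs ]′ (∈-++⁻ bs z∈H))

    labels⊆closed : ∀ {z} → z ∈ labels → z ∈ closed
    labels⊆closed z∈ = ∈-++⁺ˡ ([ ∈-++⁺ˡ ∘ ∈-++⁺ˡ , rest ]′ (∈-++⁻ es z∈))
      where
      rest : ∀ {z} → z ∈ bs ++ (αs ++ βs) → z ∈ (es ++ double αs) ++ (bs ++ double βs)
      rest z∈ = [ ∈-++⁺ʳ (es ++ double αs) ∘ ∈-++⁺ˡ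
                , [ ∈-++⁺ˡ ∘ ∈-++⁺ʳ es ∘ ∈-double⁺ αs
                  , ∈-++⁺ʳ (es ++ double αs) ∘ ∈-++⁺ʳ bs ∘ ∈-double⁺ βs ]′ ∘ ∈-++⁻ αs
                ]′ (∈-++⁻ bs z∈)

    deduplicate-↭ : deduplicate ℕ._≟_ closed ↭ labels
    deduplicate-↭ = unique-↭ (deduplicate-! ℕ._≟_ closed) labels-unique
      (closed⊆labels ∘ ∈-deduplicate⁻ ℕ._≟_ closed) (∈-deduplicate⁺ ℕ._≟_ ∘ labels⊆closed)

    value : Carrier → Carrier → Carrier → Carrier → Carrier → Carrier → Carrier
    value e α b β e′ b′ = ((e * α) * (b * β)) * (e′ * b′)

    closed-value : ∀ ψ → prodW ψ closed ≈
      value (prodW ψ es) (prodW ψ (double αs)) (prodW ψ bs) (prodW ψ (double βs)) (prodW ψ (reverse es)) (prodW ψ (reverse bs))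
    closed-value ψ = trans (prodW-++ ψ ((es ++ double αs) ++ (bs ++ double βs)) (reverse es ++ reverse bs))
      (*-cong (trans (prodW-++ ψ (es ++ double αs) (bs ++ double βs))
                     (*-cong (prodW-++ ψ es (double αs)) (prodW-++ ψ bs (double βs))))
              (prodW-++ ψ (reverse es) (reverse bs)))

    value-cong : ∀ {e₁ e₂ α₁ α₂ b₁ b₂ β₁ β₂ e′₁ e′₂ b′₁ b′₂} → e₁ ≡ e₂ → α₁ ≈ α₂ → b₁ ≡ b₂ → β₁ ≈ β₂ → e′₁ ≡ e′₂ → b′₁ ≡ b′₂ →
                 value e₁ α₁ b₁ β₁ e′₁ b′₁ ≈ value e₂ α₂ b₂ β₂ e′₂ b′₂
    value-cong ≡.refl α ≡.refl β ≡.refl ≡.refl = *-congʳ (*-cong (*-congˡ α) (*-congˡ β))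

    disjoint-reverse : ∀ {us vs : List ℕ} → Disjoint us vs → Disjoint (reverse us) vs
    disjoint-reverse d (z∈ , z∈′) = d (Anyₚ.reverse⁻ z∈ , z∈′)

    sum-βs : ∀ φ → sumOver βs φ (λ ψ → prodW ψ closed) ≈
      value (prodW φ es) (prodW φ (double αs)) (prodW φ bs) (c^ (length βs)) (prodW φ (reverse es)) (prodW φ (reverse bs))
    sum-βs φ = begin
      sumOver βs φ (λ ψ → prodW ψ closed)
        -- The labels in `βs` occur in their own block only, so all other blocks can be read off
        -- from `φ`.
        ≈⟨ sumOver-cong βs φ (λ ψ off → trans (closed-value ψ)
             (value-cong (prodW-off off es es-βs)
                         (reflexive (prodW-off off (double αs) (λ (z∈ , z∈′) → αs-βs (∈-double⁻ αs z∈ , z∈′))))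
                         (prodW-off off bs bs-βs) refl
                         (prodW-off off (reverse es) (disjoint-reverse es-βs))
                         (prodW-off off (reverse bs) (disjoint-reverse bs-βs)))) ⟩
      sumOver βs φ (λ ψ → value e α b (prodW ψ (double βs)) e′ b′)
        ≈⟨ sumOver-*ʳ βs φ _ _ ⟩
      sumOver βs φ (λ ψ → (e * α) * (b * prodW ψ (double βs))) * (e′ * b′)
        ≈⟨ *-congʳ (trans (sumOver-*ˡ βs φ _ _) (*-congˡ (trans (sumOver-*ˡ βs φ _ _) (*-congˡ (sumOver-arches βs φ βs-unique))))) ⟩
      value e α b (c^ (length βs)) e′ b′  ∎
      where
      e  = prodW φ es
      α  = prodW φ (double αs)
      b  = prodW φ bs
      e′ = prodW φ (reverse es)
      b′ = prodW φ (reverse bs)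

    sum-αs : ∀ φ → sumOver αs φ (λ ψ → sumOver βs ψ (λ ψ → prodW ψ closed)) ≈
      value (prodW φ es) (c^ (length αs)) (prodW φ bs) (c^ (length βs)) (prodW φ (reverse es)) (prodW φ (reverse bs))
    sum-αs φ = begin
      sumOver αs φ (λ ψ → sumOver βs ψ (λ ψ → prodW ψ closed))
        ≈⟨ sumOver-cong αs φ (λ ψ off → trans (sum-βs ψ)
             (value-cong (prodW-off off es es-αs) refl (prodW-off off bs bs-αs) refl
                         (prodW-off off (reverse es) (disjoint-reverse es-αs))
                         (prodW-off off (reverse bs) (disjoint-reverse bs-αs)))) ⟩
      sumOver αs φ (λ ψ → value e (prodW ψ (double αs)) b β e′ b′)
        ≈⟨ trans (sumOver-*ʳ αs φ _ _) (*-congʳ (sumOver-*ʳ αs φ _ _)) ⟩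
      (sumOver αs φ (λ ψ → e * prodW ψ (double αs)) * (b * β)) * (e′ * b′)
        ≈⟨ *-congʳ (*-congʳ (trans (sumOver-*ˡ αs φ _ _) (*-congˡ (sumOver-arches αs φ αs-unique)))) ⟩
      value e (c^ (length αs)) b β e′ b′  ∎
      where
      e  = prodW φ es
      b  = prodW φ bs
      β  = c^ (length βs)
      e′ = prodW φ (reverse es)
      b′ = prodW φ (reverse bs)

    wordValue : List (Fin 3) → List (Fin 3) → Carrier
    wordValue a b = value (word a) (c^ j) (word b) (c^ j′) (word (reverse a)) (word (reverse b))

    prodW-reverse : ∀ ψ w → prodW ψ (reverse w) ≡ word (reverse (map ψ w))
    prodW-reverse ψ w = ≡.trans (prodW-word ψ (reverse w)) (≡.cong word (Listₚ.reverse-map ψ w))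

    length-map-upTo : ∀ (f : ℕ → ℕ) n → length (map f (upTo n)) ≡ n
    length-map-upTo f n = ≡.trans (Listₚ.length-map f (upTo n)) (Listₚ.length-upTo n)

    length-arches : ∀ (f : ℕ → ℕ) j k → length (map f (arches j k)) ≡ j
    length-arches f j k = ≡.trans (Listₚ.length-map f (arches j k)) (length-map-upTo (k ℕ.+_) j)

    sum-bs : ∀ φ → sumOver bs φ (λ ψ → sumOver αs ψ (λ ψ → sumOver βs ψ (λ ψ → prodW ψ closed))) ≈
             sumWords k′ (wordValue (map φ es))
    sum-bs φ = begin
      sumOver bs φ (λ ψ → sumOver αs ψ (λ ψ → sumOver βs ψ (λ ψ → prodW ψ closed)))
        ≈⟨ sumOver-cong bs φ (λ ψ off → trans (sum-αs ψ)
             (value-cong (≡.trans (prodW-off off es es-bs) (prodW-word φ es))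
                         (reflexive (≡.cong c^ (length-arches evenL j k)))
                         (prodW-word ψ bs)
                         (reflexive (≡.cong c^ (length-arches oddL j′ k′)))
                         (≡.trans (prodW-off off (reverse es) (disjoint-reverse es-bs)) (prodW-reverse φ es))
                         (prodW-reverse ψ bs))) ⟩
      sumOver bs φ (λ ψ → wordValue (map φ es) (map ψ bs))
        ≈⟨ sumOver-words bs φ (wordValue (map φ es)) bs-unique ⟩
      sumWords (length bs) (wordValue (map φ es))
        ≡⟨ ≡.cong (λ n → sumWords n (wordValue (map φ es))) (length-map-upTo oddL k′) ⟩
      sumWords k′ (wordValue (map φ es))  ∎

    pairShare-words : pairShare (monoShare j k) (monoShare j′ k′) ≈ sumWords k (λ a → sumWords k′ (wordValue a))
    pairShare-words = begin
      wsl2 (closure (monoShare j k · monoShare j′ k′))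
        ≡⟨ ≡.cong wsl2 closure-eq ⟩
      sumAssign (deduplicate ℕ._≟_ closed) φ₀ closed
        ≈⟨ sumAssign-↭ deduplicate-↭ φ₀ closed ⟩
      sumAssign labels φ₀ closed
        ≈⟨ sumAssign-sumOver labels φ₀ closed ⟩
      sumOver labels φ₀ (λ ψ → prodW ψ closed)
        ≈⟨ sumOver-++ es _ φ₀ _ ⟩
      sumOver es φ₀ (λ ψ → sumOver (bs ++ (αs ++ βs)) ψ (λ ψ → prodW ψ closed))
        ≈⟨ sumOver-cong es φ₀ (λ ψ _ → trans (sumOver-++ bs _ ψ _)
             (trans (sumOver-cong bs ψ (λ ψ _ → sumOver-++ αs βs ψ _)) (sum-bs ψ))) ⟩
      sumOver es φ₀ (λ ψ → sumWords k′ (wordValue (map ψ es)))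
        ≈⟨ sumOver-words es φ₀ (λ a → sumWords k′ (wordValue a)) es-unique ⟩
      sumWords (length es) (λ a → sumWords k′ (wordValue a))
        ≡⟨ ≡.cong (λ n → sumWords n (λ a → sumWords k′ (wordValue a))) (length-map-upTo evenL k) ⟩
      sumWords k (λ a → sumWords k′ (wordValue a))  ∎
      where
      φ₀ : Assignment
      φ₀ _ = zero

    wordValue-scalars : ∀ a b → wordValue a b ≈ c^ j * (c^ j′ * (word a * word b * word (reverse a) * word (reverse b)))
    wordValue-scalars a b = begin
      ((word a * c^ j) * (word b * c^ j′)) * (word (reverse a) * word (reverse b))
        ≈⟨ *-congʳ (*-cong (scalar-word (c^-scalar j) a) (scalar-word (c^-scalar j′) b)) ⟨
      ((c^ j * word a) * (c^ j′ * word b)) * (word (reverse a) * word (reverse b))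
        ≈⟨ solve 6 (λ s t u v u′ v′ → ((s :* u) :* (t :* v)) :* (u′ :* v′) ⊜ s :* ((u :* t) :* (v :* u′ :* v′)))
                 refl (c^ j) (c^ j′) (word a) (word b) (word (reverse a)) (word (reverse b)) ⟩
      c^ j * ((word a * c^ j′) * (word b * word (reverse a) * word (reverse b)))
        ≈⟨ *-congˡ (*-congʳ (scalar-word (c^-scalar j′) a)) ⟨
      c^ j * ((c^ j′ * word a) * (word b * word (reverse a) * word (reverse b)))
        ≈⟨ solve 6 (λ s t u v u′ v′ → s :* ((t :* u) :* (v :* u′ :* v′)) ⊜ s :* (t :* (u :* v :* u′ :* v′)))
                 refl (c^ j) (c^ j′) (word a) (word b) (word (reverse a)) (word (reverse b)) ⟩
      c^ j * (c^ j′ * (word a * word b * word (reverse a) * word (reverse b)))  ∎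

    pairShare-scalars : pairShare (monoShare j k) (monoShare j′ k′) ≈
      c^ j * (c^ j′ * sumWords k (λ a → sumWords k′ (λ b → word a * word b * word (reverse a) * word (reverse b))))
    pairShare-scalars = trans pairShare-words (trans
      (sumWords-cong k (λ a _ → trans (sumWords-cong k′ (λ b _ → wordValue-scalars a b))
                                      (trans (sumWords-*ˡ k′ _ _) (*-congˡ (sumWords-*ˡ k′ _ _)))))
      (trans (sumWords-*ˡ k _ _) (*-congˡ (sumWords-*ˡ k _ _))))

    -- With `b` fixed, the bridges of the first share enclose `word b`.
    pairShare-T-left : pairShare (monoShare j k) (monoShare j′ k′) ≈
      c^ j * (c^ j′ * sumWords k′ (λ b → iterate T k (word b) * word (reverse b)))
    pairShare-T-left = trans pairShare-scalars (*-congˡ (*-congˡ (trans (sumWords-swap k k′ _)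
      (sumWords-cong k′ (λ b _ → trans (sumWords-*ʳ k _ _) (*-congʳ (sumWords-sandwich k (word b))))))))

    -- With `a` fixed, the bridges of the second share enclose the second reading of `a`. In this
    -- form a polynomial in the right argument can act through `T`.
    pairShare-T-right : pairShare (monoShare j k) (monoShare j′ k′) ≈
      c^ j * (c^ j′ * sumWords k (λ a → word a * iterate T k′ (word (reverse a))))
    pairShare-T-right = trans pairShare-scalars (*-congˡ (*-congˡ (sumWords-cong k (λ a _ → trans
      (sumWords-cong k′ (λ b _ → solve 4 (λ u v u′ v′ → u :* v :* u′ :* v′ ⊜ u :* (v :* u′ :* v′)) refl _ _ _ _))
      (trans (sumWords-*ˡ k′ _ _) (*-congˡ (sumWords-sandwich k′ (word (reverse a)))))))))

-- Orthogonality

length-pPoly : ∀ n → length (pPoly n) ≡ suc n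
length-pPoly n = length-monic (pPoly-monic n)
  where
  length-monic : ∀ {n P} → Monic n P → length P ≡ suc n
  length-monic top      = ≡.refl
  length-monic (lift m) = ≡.cong suc (length-monic m)

Term : Set
Term = ℤ × ℕ × ℕ

y-degree : Term → ℕ
y-degree (_ , _ , k) = k

terms-bounded : ∀ P → All (λ t → y-degree t < length P) (terms P)
terms-bounded P = Allₚ.concat⁺ (Allₚ.map⁺ (All.tabulate (λ k∈ → Allₚ.map⁺ (All.tabulate (λ _ → ∈-upTo⁻ k∈)))))

pPoly-terms : ∀ n → All (λ t → y-degree t ≤ n) (terms (pPoly n))
pPoly-terms n = All.map (λ k< → ℕ.s≤s⁻¹ (≡.subst (_ <_) (length-pPoly n) k<)) (terms-bounded (pPoly n))

module Orthogonality {a ℓ} {A : Ring a ℓ} (D : Sl2Datum A) where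
  open Ring A hiding (zero)
  open Sl2Datum D
  open WeightSystem D
  open Pairing D
  open NoncommutativeSolver A
  open Filtration D
  open Annihilation D
  open Assignments D
  open AdditiveMaps +-abelianGroup
  open import Relation.Binary.Reasoning.Setoid setoid

  private
    variable
      b : Level
      B C : Set b

  sumList : (B → Carrier) → List B → Carrier
  sumList g = foldr (λ t r → g t + r) 0#

  sumList-cong : ∀ {g h : B → Carrier} → (∀ t → g t ≈ h t) → ∀ ts → sumList g ts ≈ sumList h ts
  sumList-cong eq []       = refl
  sumList-cong eq (t ∷ ts) = +-cong (eq t) (sumList-cong eq ts)

  sumList-zero : ∀ {g : B → Carrier} {ts} → All (λ t → g t ≈ 0#) ts → sumList g ts ≈ 0#
  sumList-zero []         = refl
  sumList-zero (eq ∷ eqs) = trans (+-cong eq (sumList-zero eqs)) (+-identityˡ 0#)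

  sumList-++ : ∀ (g : B → Carrier) ts us → sumList g (ts ++ us) ≈ sumList g ts + sumList g us
  sumList-++ g []       us = sym (+-identityˡ _)
  sumList-++ g (t ∷ ts) us = trans (+-congˡ (sumList-++ g ts us)) (sym (+-assoc _ _ _))

  sumList-map : ∀ (g : C → Carrier) (f : B → C) ts → sumList g (map f ts) ≡ sumList (g ∘ f) ts
  sumList-map g f []       = ≡.refl
  sumList-map g f (t ∷ ts) = ≡.cong (λ r → _ + r) (sumList-map g f ts)

  sumList-concatMap : ∀ (g : C → Carrier) (f : B → List C) ts →
                      sumList g (concatMap f ts) ≈ sumList (λ t → sumList g (f t)) ts
  sumList-concatMap g f []       = refl
  sumList-concatMap g f (t ∷ ts) = trans (sumList-++ g (f t) (concatMap f ts)) (+-congˡ (sumList-concatMap g f ts))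

  sumList-applyUpTo : ∀ (g : B → Carrier) f n → sumList g (applyUpTo f n) ≡ Σ< n (g ∘ f)
  sumList-applyUpTo g f zero    = ≡.refl
  sumList-applyUpTo g f (suc n) = ≡.cong (λ r → _ + r) (sumList-applyUpTo g (f ∘ suc) n)

  sumList-*ˡ : ∀ u (g : B → Carrier) ts → sumList (λ t → u * g t) ts ≈ u * sumList g ts
  sumList-*ˡ u g []       = sym (zeroʳ u)
  sumList-*ˡ u g (t ∷ ts) = trans (+-congˡ (sumList-*ˡ u g ts)) (sym (distribˡ u _ _))

  sumList-*ʳ : ∀ u (g : B → Carrier) ts → sumList (λ t → g t * u) ts ≈ sumList g ts * u
  sumList-*ʳ u g []       = sym (zeroˡ u)
  sumList-*ʳ u g (t ∷ ts) = trans (+-congˡ (sumList-*ʳ u g ts)) (sym (distribʳ u _ _))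

  sumList-+ : ∀ (g h : B → Carrier) ts → sumList (λ t → g t + h t) ts ≈ sumList g ts + sumList h ts
  sumList-+ g h []       = sym (+-identityˡ 0#)
  sumList-+ g h (t ∷ ts) = trans (+-congˡ (sumList-+ g h ts))
    (solve 4 (λ a b c d → a :+ b :+ (c :+ d) ⊜ a :+ c :+ (b :+ d)) refl _ _ _ _)

  sumList-swap : ∀ (g : B → C → Carrier) ts us →
                 sumList (λ t → sumList (g t) us) ts ≈ sumList (λ u → sumList (λ t → g t u) ts) us
  sumList-swap g []       us = sym (sumList-zero (All.universal (λ _ → refl) us))
  sumList-swap g (t ∷ ts) us = trans (+-congˡ (sumList-swap g ts us)) (sym (sumList-+ (g t) _ us))

  sumList-sumWords : ∀ n (g : B → List (Fin 3) → Carrier) ts →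
                     sumList (λ t → sumWords n (g t)) ts ≈ sumWords n (λ w → sumList (λ t → g t w) ts)
  sumList-sumWords n g []       = sym (sumWords-0 n)
  sumList-sumWords n g (t ∷ ts) = trans (+-congˡ (sumList-sumWords n g ts)) (sym (sumWords-+ n (g t) _))

  termPairing : Term → Term → Carrier
  termPairing (α , j , k) (β , j′ , k′) = fromℤ (α ℤ.* β) * pairShare (monoShare j k) (monoShare j′ k′)

  pairPoly-sum : ∀ P Q → pairPoly P Q ≈ sumList (λ t → sumList (termPairing t) (terms Q)) (terms P)
  pairPoly-sum P Q = trans (sumList-concatMap (λ u → u) _ (terms P))
    (sumList-cong (λ { (α , j , k) → trans (reflexive (sumList-map (λ u → u) _ (terms Q)))
                                           (sumList-cong (λ { (β , j′ , k′) → refl }) (terms Q)) }) (terms P))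

  -- Regroups the flattened coefficients into the double sum in which `evalC-sum` and `eval-sum` are
  -- phrased.
  sumList-terms : ∀ (g : Term → Carrier) P → sumList g (terms P) ≈
    Σ< (length P) (λ k → Σ< (length (ZCY.coeff P k)) (λ j → g (ZC.coeff (ZCY.coeff P k) j , j , k)))
  sumList-terms g P = begin
    sumList g (terms P)
      ≈⟨ sumList-concatMap g _ (upTo (length P)) ⟩
    sumList (λ k → sumList g (map _ (upTo (length (ZCY.coeff P k))))) (upTo (length P))
      ≡⟨ sumList-applyUpTo (λ k → sumList g (map _ (upTo (length (ZCY.coeff P k))))) (λ k → k) (length P) ⟩
    Σ< (length P) (λ k → sumList g (map _ (upTo (length (ZCY.coeff P k)))))
      ≈⟨ Σ<-cong (length P) (λ k → reflexive (≡.trans (sumList-map g _ (upTo (length (ZCY.coeff P k))))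
           (sumList-applyUpTo _ (λ j → j) (length (ZCY.coeff P k))))) ⟩
    Σ< (length P) (λ k → Σ< (length (ZCY.coeff P k)) (λ j → g (ZC.coeff (ZCY.coeff P k) j , j , k)))  ∎

  termOp : Term → Carrier → Carrier
  termOp (α , j , k) u = fromℤ α * iterate (c *_) j (iterate T k u)

  eval-terms : ∀ P u → sumList (λ t → termOp t u) (terms P) ≈ eval P u
  eval-terms P u = begin
    sumList (λ t → termOp t u) (terms P)
      ≈⟨ sumList-terms (λ t → termOp t u) P ⟩
    Σ< (length P) (λ k → Σ< (length (ZCY.coeff P k)) (λ j → termOp (ZC.coeff (ZCY.coeff P k) j , j , k) u))
      ≈⟨ Σ<-cong (length P) (λ k → evalC-sum (ZCY.coeff P k) (iterate T k u)) ⟩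
    Σ< (length P) (λ k → evalC (ZCY.coeff P k) (iterate T k u))
      ≈⟨ eval-sum P u ⟩
    eval P u  ∎

  c^-swap : ∀ {s} → Scalar s → ∀ j u → c^ j * (s * u) ≈ s * (c^ j * u)
  c^-swap sc zero    u = trans (*-identityˡ _) (*-congˡ (sym (*-identityˡ u)))
  c^-swap {s} sc (suc j) u = begin
    c * c^ j * (s * u)    ≈⟨ *-assoc _ _ _ ⟩
    c * (c^ j * (s * u))  ≈⟨ *-congˡ (c^-swap sc j u) ⟩
    c * (s * (c^ j * u))  ≈⟨ Linear.*-homo c*-linear sc _ ⟩
    s * (c * (c^ j * u))  ≈⟨ *-congˡ (*-assoc _ _ _) ⟨
    s * (c * c^ j * u)    ∎

  iterate-c : ∀ j u → iterate (c *_) j u ≈ c^ j * u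
  iterate-c zero    u = sym (*-identityˡ u)
  iterate-c (suc j) u = begin
    iterate (c *_) j (c * u)  ≈⟨ iterate-c j (c * u) ⟩
    c^ j * (c * u)            ≈⟨ c^-swap c-scalar j u ⟩
    c * (c^ j * u)            ≈⟨ *-assoc _ _ _ ⟨
    c * c^ j * u              ∎

  termCoeff : Term → Carrier
  termCoeff (α , j , k) = fromℤ α * c^ j

  termCoeff-scalar : ∀ t → Scalar (termCoeff t)
  termCoeff-scalar (α , j , k) i = begin
    fromℤ α * c^ j * x i    ≈⟨ *-assoc _ _ _ ⟩
    fromℤ α * (c^ j * x i)  ≈⟨ *-congˡ (c^-scalar j i) ⟩
    fromℤ α * (x i * c^ j)  ≈⟨ *-assoc _ _ _ ⟨
    fromℤ α * x i * c^ j    ≈⟨ *-congʳ (fromℤ-central α (x i)) ⟩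
    x i * fromℤ α * c^ j    ≈⟨ *-assoc _ _ _ ⟩
    x i * (fromℤ α * c^ j)  ∎

  termOp-coeff : ∀ t u → termOp t u ≈ termCoeff t * iterate T (y-degree t) u
  termOp-coeff (α , j , k) u = trans (*-congˡ (iterate-c j _)) (sym (*-assoc _ _ _))

  central-swap : ∀ {s} → Central s → ∀ t u → s * (t * u) ≈ t * (s * u)
  central-swap {s} sc t u = trans (sym (*-assoc _ _ _)) (trans (*-congʳ (sc t)) (*-assoc _ _ _))

  -- The coefficient of `t′` moves inward, past `word w`, to its power of `T`; summing over `t′`
  -- then gives the evaluation of a whole polynomial.
  termPairing-right : ∀ t t′ → termPairing t t′ ≈
    termCoeff t * sumWords (y-degree t) (λ w → word w * termOp t′ (word (reverse w)))
  termPairing-right t@(α , j , k) t′@(β , j′ , k′) = begin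
    fromℤ (α ℤ.* β) * pairShare (monoShare j k) (monoShare j′ k′)
      ≈⟨ *-cong (fromℤ-* α β) (MonomialPairing.pairShare-T-right j k j′ k′) ⟩
    fromℤ α * fromℤ β * (c^ j * (c^ j′ * Y))
      ≈⟨ trans (*-assoc _ _ _) (*-congˡ (central-swap (fromℤ-central β) _ _)) ⟩
    fromℤ α * (c^ j * (fromℤ β * (c^ j′ * Y)))
      ≈⟨ trans (sym (*-assoc _ _ _)) (*-congˡ (sym (*-assoc _ _ _))) ⟩
    termCoeff t * (termCoeff t′ * Y)
      ≈⟨ *-congˡ (sumWords-*ˡ k _ _) ⟨
    termCoeff t * sumWords k (λ w → termCoeff t′ * (word w * iterate T k′ (word (reverse w))))
      ≈⟨ *-congˡ (sumWords-cong k (λ w _ → begin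
           termCoeff t′ * (word w * iterate T k′ (word (reverse w)))  ≈⟨ *-assoc _ _ _ ⟨
           termCoeff t′ * word w * iterate T k′ (word (reverse w))    ≈⟨ *-congʳ (scalar-word (termCoeff-scalar t′) w) ⟩
           word w * termCoeff t′ * iterate T k′ (word (reverse w))    ≈⟨ *-assoc _ _ _ ⟩
           word w * (termCoeff t′ * iterate T k′ (word (reverse w)))  ≈⟨ *-congˡ (termOp-coeff t′ _) ⟨
           word w * termOp t′ (word (reverse w))                      ∎)) ⟩
    termCoeff t * sumWords k (λ w → word w * termOp t′ (word (reverse w)))  ∎
    where
    Y = sumWords k (λ w → word w * iterate T k′ (word (reverse w)))

  termPairing-left : ∀ t t′ → termPairing t t′ ≈
    termCoeff t′ * sumWords (y-degree t′) (λ w → termOp t (word w) * word (reverse w))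
  termPairing-left t@(α , j , k) t′@(β , j′ , k′) = begin
    fromℤ (α ℤ.* β) * pairShare (monoShare j k) (monoShare j′ k′)
      ≈⟨ *-cong (trans (fromℤ-* α β) (fromℤ-central α _)) (MonomialPairing.pairShare-T-left j k j′ k′) ⟩
    fromℤ β * fromℤ α * (c^ j * (c^ j′ * Y))
      -- The two powers of `c` change places so that the coefficient of `t` can reach its operator.
      ≈⟨ trans (*-congˡ (c^-swap (c^-scalar j′) j Y)) (trans (*-assoc _ _ _) (*-congˡ (central-swap (fromℤ-central α) _ _))) ⟩
    fromℤ β * (c^ j′ * (fromℤ α * (c^ j * Y)))
      ≈⟨ trans (sym (*-assoc _ _ _)) (*-congˡ (sym (*-assoc _ _ _))) ⟩
    termCoeff t′ * (termCoeff t * Y)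
      ≈⟨ *-congˡ (sumWords-*ˡ k′ _ _) ⟨
    termCoeff t′ * sumWords k′ (λ w → termCoeff t * (iterate T k (word w) * word (reverse w)))
      ≈⟨ *-congˡ (sumWords-cong k′ (λ w _ → trans (sym (*-assoc _ _ _)) (*-congʳ (sym (termOp-coeff t (word w)))))) ⟩
    termCoeff t′ * sumWords k′ (λ w → termOp t (word w) * word (reverse w))  ∎
    where
    Y = sumWords k′ (λ w → iterate T k (word w) * word (reverse w))

  F-mono : ∀ {m n u} → m ≤ n → F m u → F n u
  F-mono = climb ∘ ℕₚ.≤⇒≤′
    where
    climb : ∀ {m n u} → m ℕ.≤′ n → F m u → F n u
    climb (ℕ.≤′-reflexive ≡.refl) f = f
    climb (ℕ.≤′-step m≤n)         f = up∈ (climb m≤n f)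

  word∈ : ∀ w → F (suc (length w)) (word w)
  word∈ []      = one∈
  word∈ (i ∷ w) = x∈ i (word∈ w)

  -- `word w` lies in `F (suc (length w))`; the strict inequality absorbs the successor.
  pPoly-word : ∀ {n} w → length w < n → eval (pPoly n) (word w) ≈ 0#
  pPoly-word {n} w len = pPoly-annihilates n (F-mono len (word∈ w))

  -- Each monomial `t` of `P` contributes zero by itself: for fixed `w` the terms of `pPoly n` add
  -- up to its evaluation at a word of fewer than `n` letters.
  pairPoly-right-zero : ∀ P {n} → All (λ t → y-degree t < n) (terms P) → pairPoly P (pPoly n) ≈ 0#
  pairPoly-right-zero P {n} bound = trans (pairPoly-sum P (pPoly n)) (sumList-zero (All.map (λ {t} → vanish t) bound))
    where
    vanish : ∀ t → y-degree t < n → sumList (termPairing t) (terms (pPoly n)) ≈ 0#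
    vanish t k<n = begin
      sumList (termPairing t) ts
        ≈⟨ sumList-cong (termPairing-right t) ts ⟩
      sumList (λ t′ → termCoeff t * sumWords k (λ w → word w * termOp t′ (word (reverse w)))) ts
        ≈⟨ trans (sumList-*ˡ _ _ ts) (*-congˡ (sumList-sumWords k _ ts)) ⟩
      termCoeff t * sumWords k (λ w → sumList (λ t′ → word w * termOp t′ (word (reverse w))) ts)
        ≈⟨ *-congˡ (sumWords-cong k (λ w len → begin
             sumList (λ t′ → word w * termOp t′ (word (reverse w))) ts
               ≈⟨ sumList-*ˡ _ _ ts ⟩
             word w * sumList (λ t′ → termOp t′ (word (reverse w))) ts
               ≈⟨ *-congˡ (trans (eval-terms (pPoly n) _)
                    (pPoly-word (reverse w) (≡.subst (_< n) (≡.sym (≡.trans (Listₚ.length-reverse w) len)) k<n))) ⟩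
             word w * 0#
               ≈⟨ zeroʳ _ ⟩
             0# ∎)) ⟩
      termCoeff t * sumWords k (λ _ → 0#)
        ≈⟨ trans (*-congˡ (sumWords-0 k)) (zeroʳ _) ⟩
      0#  ∎
      where
      k = y-degree t
      ts = terms (pPoly n)

  pairPoly-left-zero : ∀ Q {n} → All (λ t → y-degree t < n) (terms Q) → pairPoly (pPoly n) Q ≈ 0#
  pairPoly-left-zero Q {n} bound = trans (pairPoly-sum (pPoly n) Q)
    -- The sums are exchanged so that, for each monomial of `Q`, the terms of `pPoly n` are added up
    -- first.
    (trans (sumList-swap termPairing (terms (pPoly n)) (terms Q)) (sumList-zero (All.map (λ {t} → vanish t) bound)))
    where
    vanish : ∀ t′ → y-degree t′ < n → sumList (λ t → termPairing t t′) (terms (pPoly n)) ≈ 0#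
    vanish t′ k<n = begin
      sumList (λ t → termPairing t t′) ts
        ≈⟨ sumList-cong (λ t → termPairing-left t t′) ts ⟩
      sumList (λ t → termCoeff t′ * sumWords k (λ w → termOp t (word w) * word (reverse w))) ts
        ≈⟨ trans (sumList-*ˡ _ _ ts) (*-congˡ (sumList-sumWords k _ ts)) ⟩
      termCoeff t′ * sumWords k (λ w → sumList (λ t → termOp t (word w) * word (reverse w)) ts)
        ≈⟨ *-congˡ (sumWords-cong k (λ w len → begin
             sumList (λ t → termOp t (word w) * word (reverse w)) ts
               ≈⟨ sumList-*ʳ _ _ ts ⟩
             sumList (λ t → termOp t (word w)) ts * word (reverse w)
               ≈⟨ *-congʳ (trans (eval-terms (pPoly n) _) (pPoly-word w (≡.subst (_< n) (≡.sym len) k<n))) ⟩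
             0# * word (reverse w)
               ≈⟨ zeroˡ _ ⟩
             0# ∎)) ⟩
      termCoeff t′ * sumWords k (λ _ → 0#)
        ≈⟨ trans (*-congˡ (sumWords-0 k)) (zeroʳ _) ⟩
      0#  ∎
      where
      k = y-degree t′
      ts = terms (pPoly n)

  pPoly-orthogonal : ∀ n k → n ≢ k → pairPoly (pPoly n) (pPoly k) ≈ 0#
  pPoly-orthogonal n k n≢k with ℕₚ.<-cmp n k
  ... | tri< n<k _ _ = pairPoly-right-zero (pPoly n) (All.map (λ d≤n → ℕₚ.≤-<-trans d≤n n<k) (pPoly-terms n))
  ... | tri≈ _ n≡k _ = ⊥-elim (n≢k n≡k)
  ... | tri> _ _ k<n = pairPoly-left-zero (pPoly k) (All.map (λ d≤k → ℕₚ.≤-<-trans d≤k k<n) (pPoly-terms k))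

theorem5 : ∀ {a ℓ : Level}
    → (∀ (K : CommutativeRing a ℓ) → OverRing.IsBasis K)
    × (∀ (A : Ring a ℓ) (D : Sl2Datum A) (n k : ℕ) → n ≢ k
    → Ring._≈_ A (Pairing.pairPoly D (pPoly n) (pPoly k)) (Ring.0# A))
theorem5 = Basis.isBasis , λ A D → Orthogonality.pPoly-orthogonal D
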